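{- Let $M$ be a set system on $[n]$. Then $M$ is a strong $\Delta$-matroid if and only if - it has no peerless antipode in any $3$-cube or $4$-cube, and - it has no isolated antipode in any $k$-cube for $k\ge5$.
   Context: A set system on $[n]=\{1,\dots,n\}$ is a (possibly empty) collection of subsets of $[n]$; $\triangle$ is symmetric difference (when $a=b$, $\{a,b\}=\{a\}$). A $\Delta$-matroid is a set system $M$ such that for all $A,B\in M$ and $a\in A\triangle B$ there exists $b\in A\triangle B$ (possibly $b=a$) with $A\triangle\{a,b\}\in M$. A $\Delta$-matroid $M$ is strong if it satisfies the hyperplane exchange property: for all distinct $A,B\in M$ there exist (possibly equal) $a,b\in A\triangle B$ such that $A\triangle\{a,b\}\in M$ and $B\triangle\{a,b\}\in M$. For $S\subseteq[n]$ let $\varepsilon_S\in\mathbb R^n$ be its indicator vector. For $I,J\subseteq[n]$ let $\square_{I,J}=\operatorname{conv}\{\varepsilon_S: I\cap J\subseteq S\subseteq I\cup J\}$; it is a $k$-cube when $|I\triangle J|=k$. For $I,J\in M$: $(I,J)$ is a peerless antipode of $M$ in $\square_{I,J}$ if whenever $S,T\in M$ satisfy $S\cap T=I\cap J$ and $S\triangle T=I\triangle J$, then $\{S,T\}=\{I,J\}$; $(I,J)$ is an isolated antipode of $M$ in $\square_{I,J}$ if whenever $S\in M$ satisfies $I\cap J\subseteq S\subseteq I\cup J$, then $S=I$ or $S=J$. "$M$ has a peerless (isolated) antipode in a $k$-cube" means there are $I,J\in M$ with $|I\triangle J|=k$ such that $(I,J)$ is a peerless (isolated) antipode of $M$ in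 $\square_{I,J}$. -}

module Defs where

open import Data.Bool.Base using (_xor_)
open import Data.Fin.Base using (Fin)
open import Data.Fin.Subset using (Subset; _∈_; _⊆_; _∩_; _∪_; ⁅_⁆; ∣_∣)
open import Data.Nat.Base using (ℕ)
open import Data.Product.Base using (_×_; ∃-syntax)
open import Data.Sum.Base using (_⊎_)
open import Data.Vec.Base using (zipWith)
open import Level using (Level; suc)
open import Relation.Binary.PropositionalEquality.Core using (_≡_; _≢_)
open import Relation.Unary using (Pred)

private
  variable
    n : ℕ
    ℓ : Level

-- A finite collection of subsets is a decidable such predicate; decidability
-- is a separate hypothesis where the theorem is stated.
SetSystem : ℕ → (ℓ : Level) → Set (suc ℓ)
SetSystem n ℓ = Pred (Subset n) ℓ

infixl 5 _△_

_△_ : Subset n → Subset n → Subset n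
_△_ = zipWith _xor_

-- Below, {a, b} is written ⁅ a ⁆ ∪ ⁅ b ⁆, which is the singleton when a = b.

IsΔMatroid : SetSystem n ℓ → Set ℓ
IsΔMatroid M =
  ∀ A B → M A → M B → ∀ a → a ∈ A △ B →
  ∃[ b ] b ∈ A △ B × M (A △ (⁅ a ⁆ ∪ ⁅ b ⁆))

HyperplaneExchange : SetSystem n ℓ → Set ℓ
HyperplaneExchange M =
  ∀ A B → M A → M B → A ≢ B →
  ∃[ a ] ∃[ b ] a ∈ A △ B × b ∈ A △ B ×
    M (A △ (⁅ a ⁆ ∪ ⁅ b ⁆)) × M (B △ (⁅ a ⁆ ∪ ⁅ b ⁆))

IsStrongΔMatroid : SetSystem n ℓ → Set ℓ
IsStrongΔMatroid M = IsΔMatroid M × HyperplaneExchange M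

-- The cube □_{I,J} enters only through its vertices ε_S, that is, through
-- the subsets S with I ∩ J ⊆ S ⊆ I ∪ J; its dimension is ∣ I △ J ∣.

-- The conclusion is the equality of unordered pairs {S, T} = {I, J}.
IsPeerlessAntipode : SetSystem n ℓ → Subset n → Subset n → Set ℓ
IsPeerlessAntipode M I J =
  ∀ S T → M S → M T → S ∩ T ≡ I ∩ J → S △ T ≡ I △ J →
  (S ≡ I × T ≡ J) ⊎ (S ≡ J × T ≡ I)

IsIsolatedAntipode : SetSystem n ℓ → Subset n → Subset n → Set ℓ
IsIsolatedAntipode M I J =
  ∀ S → M S → I ∩ J ⊆ S → S ⊆ I ∪ J → S ≡ I ⊎ S ≡ J

HasPeerlessAntipode : SetSystem n ℓ → ℕ → Set ℓ
HasPeerlessAntipode M k =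
  ∃[ I ] ∃[ J ] M I × M J × ∣ I △ J ∣ ≡ k × IsPeerlessAntipode M I J

HasIsolatedAntipode : SetSystem n ℓ → ℕ → Set ℓ
HasIsolatedAntipode M k =
  ∃[ I ] ∃[ J ] M I × M J × ∣ I △ J ∣ ≡ k × IsIsolatedAntipode M I J

{-# OPTIONS --safe #-}
-- If |A △ B| ≥ 3, hyperplane exchange provides a proper nonempty U ⊆ A △ B with
-- A △ U and B △ U feasible, and such a U rules out a peerless antipode.
--
-- Conversely, add an element * to the odd feasible sets, so that all feasible
-- sets become even, and prove simultaneous exchange there: for every a ∈ A △ B
-- there is b ≠ a in A △ B with A △ {a, b} and B △ {a, b} feasible. For |A △ B|
-- = 4 this follows from the absence of peerless antipodes in 3-cubes and
-- 4-cubes; the one delicate case is * ∉ A △ B with the two peers of A and B at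
-- odd distance from them. For larger A △ B consider the graphs G and H on A △ B
-- formed by the pairs {a, b} with A △ {a, b}, respectively B △ {a, b},
-- feasible. A feasible set strictly between A and B makes both nonempty, and
-- exchange at smaller distance shows that, if they had no common edge, both
-- would be complete multipartite; but the complement of a complete multipartite
-- graph with an edge is disconnected, so it cannot contain another one.

module Submission where

open import Defs
open import Data.Bool.Base using (Bool; true; false; _∧_; _xor_; not)
open import Data.Bool.Properties
  using (¬-not; not-distribˡ-xor; not-distribʳ-xor; xor-annihilates-not;
         xor-assoc; xor-comm; xor-identityˡ; xor-identityʳ; xor-same)
  renaming (_≟_ to _≟ᵇ_)
open import Data.Fin.Base using (Fin; zero; suc)
open import Data.Fin.Properties using (_≟_)
open import Data.Fin.Subset
open import Data.Fin.Subset.Properties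
open import Data.List.Base using ([]; _∷_)
open import Data.List.Relation.Binary.Permutation.Propositional as ↭ using ()
open import Data.List.Relation.Binary.Permutation.Propositional.Properties using (Any-resp-↭)
open import Data.List.Relation.Unary.Any as Any using (Any; here; there)
import Data.List.Relation.Unary.Any.Properties as Any
open import Data.Nat.Base using (ℕ; zero; suc; _≤_; _<_; s≤s; z≤n; s≤s⁻¹)
open import Data.Nat.Properties using (≤-trans; ≤-refl; <-≤-trans; n≤1+n; m≤m+n)
open import Data.Product.Base using (_×_; _,_; ∃-syntax; proj₁; proj₂)
open import Data.Sum.Base using (_⊎_; inj₁; inj₂)
open import Data.Vec.Base using (Vec; []; _∷_; here; there; lookup; map; tail)
open import Data.Vec.Properties
  using (≡-dec; zipWith-assoc; zipWith-comm; zipWith-identityˡ; zipWith-identityʳ)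
open import Function.Base using (_∘_)
open import Function.Bundles using (_⇔_; mk⇔)
open import Level using (Level)
open import Relation.Binary.Definitions using (DecidableEquality)
open import Relation.Binary.PropositionalEquality
import Relation.Binary.Reflection as Reflection
open import Relation.Nullary using (Dec; yes; no; contradiction; ¬?)
open import Relation.Nullary.Decidable using (_×-dec_)
open import Relation.Nullary.Negation.Core using (¬_)
open import Relation.Unary using (Decidable)

private
  variable
    ℓ : Level
    n k : ℕ
    a b c d e x y : Fin n
    A B C D S T U V : Subset n

_≟ˢ_ : DecidableEquality (Subset n)
_≟ˢ_ = ≡-dec _≟ᵇ_

-- The elementary abelian 2-group of subsets.

△-comm : (S T : Subset n) → S △ T ≡ T △ S
△-comm = zipWith-comm xor-comm

△-assoc : (S T U : Subset n) → (S △ T) △ U ≡ S △ (T △ U)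
△-assoc = zipWith-assoc xor-assoc

△-identityˡ : (S : Subset n) → ⊥ △ S ≡ S
△-identityˡ = zipWith-identityˡ xor-identityˡ

△-identityʳ : (S : Subset n) → S △ ⊥ ≡ S
△-identityʳ = zipWith-identityʳ xor-identityʳ

△-self : (S : Subset n) → S △ S ≡ ⊥
△-self []      = refl
△-self (s ∷ S) = cong₂ _∷_ (xor-same s) (△-self S)

-- The bits are coefficients over the two-element field. Applied to singletons, the same function
-- enumerates the subsets of a list of elements, which `⊆-select` exploits.
select : Vec Bool k → Vec (Subset n) k → Subset n
select []           []      = ⊥
select (true  ∷ bs) (S ∷ Ss) = S △ select bs Ss
select (false ∷ bs) (S ∷ Ss) = select bs Ss

-- A solver for equations in the elementary abelian 2-group (Subset n, △).

infixl 5 _⊕_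

data Sum (k : ℕ) : Set where
  var : Fin k → Sum k
  ∅   : Sum k
  _⊕_ : Sum k → Sum k → Sum k

⟦_⟧ : Sum k → Vec (Subset n) k → Subset n
⟦ var i ⟧ ρ = lookup ρ i
⟦ ∅     ⟧ ρ = ⊥
⟦ e ⊕ f ⟧ ρ = ⟦ e ⟧ ρ △ ⟦ f ⟧ ρ

-- In a commutative group of exponent 2 only the parity of the number of occurrences of each
-- variable counts, so a `Subset k` serves as a normal form.
normalise : Sum k → Subset k
normalise (var i) = ⁅ i ⁆
normalise ∅       = ⊥
normalise (e ⊕ f) = normalise e △ normalise f

select-⊥ : (ρ : Vec (Subset n) k) → select ⊥ ρ ≡ ⊥
select-⊥ []      = refl
select-⊥ (S ∷ ρ) = select-⊥ ρ

select-⁅⁆ : (i : Fin k) (ρ : Vec (Subset n) k) → select ⁅ i ⁆ ρ ≡ lookup ρ i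
select-⁅⁆ zero    (S ∷ ρ) = trans (cong (S △_) (select-⊥ ρ)) (△-identityʳ S)
select-⁅⁆ (suc i) (S ∷ ρ) = select-⁅⁆ i ρ

select-△ : (bs cs : Vec Bool k) (ρ : Vec (Subset n) k) →
           select (bs △ cs) ρ ≡ select bs ρ △ select cs ρ
select-△ []           []           []      = sym (△-self ⊥)
select-△ (false ∷ bs) (false ∷ cs) (S ∷ ρ) = select-△ bs cs ρ
select-△ (false ∷ bs) (true  ∷ cs) (S ∷ ρ) = begin
  S △ select (bs △ cs) ρ              ≡⟨ cong (S △_) (select-△ bs cs ρ) ⟩
  S △ (select bs ρ △ select cs ρ)     ≡⟨ △-assoc S _ _ ⟨
  (S △ select bs ρ) △ select cs ρ     ≡⟨ cong (_△ select cs ρ) (△-comm S _) ⟩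
  (select bs ρ △ S) △ select cs ρ     ≡⟨ △-assoc _ S _ ⟩
  select bs ρ △ (S △ select cs ρ)     ∎
  where open ≡-Reasoning
select-△ (true ∷ bs) (false ∷ cs) (S ∷ ρ) =
  trans (cong (S △_) (select-△ bs cs ρ)) (sym (△-assoc S _ _))
-- The two copies of `S` on the right cancel; read from the left, they are inserted as `S △ S`,
-- which is `⊥`.
select-△ (true ∷ bs) (true ∷ cs) (S ∷ ρ) = begin
  select (bs △ cs) ρ                      ≡⟨ select-△ bs cs ρ ⟩
  select bs ρ △ select cs ρ               ≡⟨ cong (_△ select cs ρ) (△-identityʳ _) ⟨
  (select bs ρ △ ⊥) △ select cs ρ         ≡⟨ cong (λ T → (select bs ρ △ T) △ select cs ρ) (△-self S) ⟨
  (select bs ρ △ (S △ S)) △ select cs ρ   ≡⟨ cong (_△ select cs ρ) (△-assoc _ S S) ⟨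
  ((select bs ρ △ S) △ S) △ select cs ρ   ≡⟨ △-assoc _ S _ ⟩
  (select bs ρ △ S) △ (S △ select cs ρ)   ≡⟨ cong (_△ (S △ select cs ρ)) (△-comm _ S) ⟩
  (S △ select bs ρ) △ (S △ select cs ρ)   ∎
  where open ≡-Reasoning

normalise-correct : (e : Sum k) (ρ : Vec (Subset n) k) → select (normalise e) ρ ≡ ⟦ e ⟧ ρ
normalise-correct (var i) ρ = select-⁅⁆ i ρ
normalise-correct ∅       ρ = select-⊥ ρ
normalise-correct (e ⊕ f) ρ = trans (select-△ (normalise e) (normalise f) ρ)
  (cong₂ _△_ (normalise-correct e ρ) (normalise-correct f ρ))

infix 4 _⊜_

_⊜_ : Sum k → Sum k → Sum k × Sum k
_⊜_ = _,_

module _ {n : ℕ} where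
  open Reflection (setoid (Subset n)) var ⟦_⟧ (select ∘ normalise) normalise-correct public
    using (solve)

-- Elements and cardinality of symmetric differences.

∈-△ˡ : x ∈ S → x ∉ T → x ∈ S △ T
∈-△ˡ {T = true  ∷ _} here        x∉T = contradiction here x∉T
∈-△ˡ {T = false ∷ _} here        x∉T = here
∈-△ˡ {T = _     ∷ _} (there x∈S) x∉T = there (∈-△ˡ x∈S (x∉T ∘ there))

∈-△ʳ : x ∉ S → x ∈ T → x ∈ S △ T
∈-△ʳ {S = S} {T = T} x∉S x∈T = subst (_ ∈_) (△-comm T S) (∈-△ˡ x∈T x∉S)

∉-△ : x ∈ S → x ∈ T → x ∉ S △ T
∉-△ here        here        ()
∉-△ (there x∈S) (there x∈T) (there x∈S△T) = ∉-△ x∈S x∈T x∈S△T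

∈-△⁻ : x ∈ S △ T → (x ∈ S × x ∉ T) ⊎ (x ∉ S × x ∈ T)
∈-△⁻ {x = x} {S = S} {T = T} x∈S△T with x ∈? S | x ∈? T
... | yes x∈S | yes x∈T = contradiction x∈S△T (∉-△ x∈S x∈T)
... | yes x∈S | no  x∉T = inj₁ (x∈S , x∉T)
... | no  x∉S | yes x∈T = inj₂ (x∉S , x∈T)
-- As `T` is `S △ (S △ T)`, an element of `S △ T` outside `S` must lie in `T`.
... | no  x∉S | no  x∉T =
  contradiction (subst (x ∈_) T≡S△T△S (∈-△ʳ x∉S x∈S△T)) x∉T
  where
  T≡S△T△S : S △ (S △ T) ≡ T
  T≡S△T△S = solve 2 (λ S T → S ⊕ (S ⊕ T) ⊜ T) refl S T

△-⊆ : S ⊆ U → T ⊆ U → S △ T ⊆ U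
△-⊆ S⊆U T⊆U x∈S△T with ∈-△⁻ x∈S△T
... | inj₁ (x∈S , _) = S⊆U x∈S
... | inj₂ (_ , x∈T) = T⊆U x∈T

∈-remove⁺ : x ∈ S → x ≢ a → x ∈ S △ ⁅ a ⁆
∈-remove⁺ x∈S x≢a = ∈-△ˡ x∈S (x≢y⇒x∉⁅y⁆ x≢a)

∉-remove : a ∈ S → a ∉ S △ ⁅ a ⁆
∉-remove {a = a} a∈S = ∉-△ a∈S (x∈⁅x⁆ a)

∈-remove⁻ : a ∈ S → x ∈ S △ ⁅ a ⁆ → x ∈ S × x ≢ a
∈-remove⁻ {a = a} a∈S x∈ with ∈-△⁻ x∈
... | inj₁ (x∈S , x∉a) = x∈S , x∉⁅y⁆⇒x≢y x∉a
... | inj₂ (x∉S , x∈a) = contradiction (subst (_∈ _) (sym (x∈⁅y⁆⇒x≡y a x∈a)) a∈S) x∉S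

∣remove∣ : a ∈ S → ∣ S ∣ ≡ suc ∣ S △ ⁅ a ⁆ ∣
∣remove∣ {S = true ∷ S} here = cong (suc ∘ ∣_∣) (sym (△-identityʳ S))
∣remove∣ {S = true  ∷ S} (there a∈S) = cong suc (∣remove∣ a∈S)
∣remove∣ {S = false ∷ S} (there a∈S) = ∣remove∣ a∈S

∣add∣ : a ∉ S → ∣ S △ ⁅ a ⁆ ∣ ≡ suc ∣ S ∣
∣add∣ {a = a} {S = S} a∉S = trans (∣remove∣ (∈-△ʳ a∉S (x∈⁅x⁆ a)))
  (cong (suc ∘ ∣_∣) (solve 2 (λ S a → S ⊕ a ⊕ a ⊜ S) refl S ⁅ a ⁆))

△≡⊥⇒≡ : S △ T ≡ ⊥ → S ≡ T
△≡⊥⇒≡ {S = S} {T = T} S△T≡⊥ = begin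
  S            ≡⟨ solve 2 (λ S T → S ⊜ S ⊕ T ⊕ T) refl S T ⟩
  S △ T △ T    ≡⟨ cong (_△ T) S△T≡⊥ ⟩
  ⊥ △ T        ≡⟨ △-identityˡ T ⟩
  T            ∎
  where open ≡-Reasoning

≢⊥⇒Nonempty : S ≢ ⊥ → Nonempty S
≢⊥⇒Nonempty {S = S} S≢⊥ with nonempty? S
... | yes p = p
... | no ¬p = contradiction (Empty-unique ¬p) S≢⊥

-- The bits are read off one by one: an element of `as` that lies in `U` is toggled out of `U`
-- before the rest is treated. This turns an unknown `U` inside a difference of three or four
-- elements into a finite case split.
⊆-select : (as : Vec (Fin n) k) → U ⊆ select ⊤ (map ⁅_⁆ as) →
           ∃[ bs ] U ≡ select bs (map ⁅_⁆ as)
⊆-select [] U⊆ = [] , ⊆-antisym U⊆ ⊥⊆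
⊆-select {U = U} (a ∷ as) U⊆ with a ∈? U
... | no a∉U with ⊆-select as U⊆as
  where
  U⊆as : U ⊆ select ⊤ (map ⁅_⁆ as)
  U⊆as x∈U with ∈-△⁻ (U⊆ x∈U)
  ... | inj₁ (x∈a , _) = contradiction (subst (_∈ U) (x∈⁅y⁆⇒x≡y a x∈a) x∈U) a∉U
  ... | inj₂ (_ , x∈as) = x∈as
...   | bs , eq = false ∷ bs , eq
⊆-select {U = U} (a ∷ as) U⊆ | yes a∈U with ⊆-select as U△a⊆as
  where
  U△a⊆as : U △ ⁅ a ⁆ ⊆ select ⊤ (map ⁅_⁆ as)
  U△a⊆as x∈ with ∈-remove⁻ a∈U x∈
  ... | x∈U , x≢a with ∈-△⁻ (U⊆ x∈U)
  ...   | inj₁ (x∈a , _) = contradiction (x∈⁅y⁆⇒x≡y a x∈a) x≢a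
  ...   | inj₂ (_ , x∈as) = x∈as
... | bs , eq = true ∷ bs , (begin
  U                    ≡⟨ solve 2 (λ U a → U ⊜ a ⊕ (U ⊕ a)) refl U ⁅ a ⁆ ⟩
  ⁅ a ⁆ △ (U △ ⁅ a ⁆)  ≡⟨ cong (⁅ a ⁆ △_) eq ⟩
  ⁅ a ⁆ △ select bs (map ⁅_⁆ as) ∎)
  where open ≡-Reasoning

-- Swaps and antipodal pairs of a cube.

Swap : SetSystem n ℓ → Subset n → Subset n → Subset n → Set ℓ
Swap M A B U = M (A △ U) × M (B △ U)

-- For `U ⊆ A △ B` the sets `A △ U` and `B △ U` are opposite vertices of the cube spanned by `A` and
-- `B`, and every opposite pair arises in this way. The two inequalities exclude the pair `A`, `B`
-- itself, in either order. A proper swap is thus a witness against peerlessness.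
ProperSwap : SetSystem n ℓ → Subset n → Subset n → Set ℓ
ProperSwap M A B = ∃[ U ] U ⊆ A △ B × U ≢ ⊥ × U ≢ A △ B × Swap M A B U

-- Where `V` contains an element, exactly one of `A` and `B` does, so toggling both leaves the
-- conjunction false.
△-∩-invariant : ∀ {V} (A B : Subset n) → V ⊆ A △ B → (A △ V) ∩ (B △ V) ≡ A ∩ B
△-∩-invariant {V = []}    []      []      V⊆ = refl
△-∩-invariant {V = v ∷ V} (x ∷ A) (y ∷ B) V⊆ =
  cong₂ _∷_ (head x y v V⊆) (△-∩-invariant A B (drop-∷-⊆ V⊆))
  where
  head : ∀ x y v → v ∷ V ⊆ (x xor y) ∷ (A △ B) → (x xor v) ∧ (y xor v) ≡ x ∧ y
  head false false false V⊆ = refl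
  head false true  false V⊆ = refl
  head true  false false V⊆ = refl
  head true  true  false V⊆ = refl
  head false true  true  V⊆ = refl
  head true  false true  V⊆ = refl
  head false false true  V⊆ with () ← V⊆ here
  head true  true  true  V⊆ with () ← V⊆ here

-- Outside `A △ B` the intersection and the union of `A` and `B` coincide, so `C` has to agree with
-- `A` there.
interval⇒△-⊆ : ∀ (A B C : Subset n) → A ∩ B ⊆ C → C ⊆ A ∪ B → A △ C ⊆ A △ B
interval⇒△-⊆ A B C lower upper {x} x∈A△C with ∈-△⁻ x∈A△C | x ∈? B
... | inj₁ (x∈A , x∉C) | yes x∈B = contradiction (lower (x∈p∩q⁺ (x∈A , x∈B))) x∉C
... | inj₁ (x∈A , x∉C) | no  x∉B = ∈-△ˡ x∈A x∉B
... | inj₂ (x∉A , x∈C) | yes x∈B = ∈-△ʳ x∉A x∈B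
... | inj₂ (x∉A , x∈C) | no  x∉B with x∈p∪q⁻ A B (upper x∈C)
...   | inj₁ x∈A = contradiction x∈A x∉A
...   | inj₂ x∈B = contradiction x∈B x∉B

-- Outside `A △ B`, an element of `A` lies in `A ∩ B`, hence in `S ∩ T`. An element of `S` there
-- lies outside `S △ T`, so it belongs to `S ∩ T` and hence to `A`.
antipode⇒△-⊆ : ∀ (A B S T : Subset n) → S ∩ T ≡ A ∩ B → S △ T ≡ A △ B → A △ S ⊆ A △ B
antipode⇒△-⊆ A B S T ∩≡ △≡ {x} x∈A△S with x ∈? (A △ B)
... | yes x∈A△B = x∈A△B
... | no  x∉A△B with ∈-△⁻ x∈A△S | x ∈? B | x ∈? T
...   | inj₁ (x∈A , x∉S) | no  x∉B | _ = ∈-△ˡ x∈A x∉B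
...   | inj₁ (x∈A , x∉S) | yes x∈B | _ =
  contradiction (p∩q⊆p S T (subst (x ∈_) (sym ∩≡) (x∈p∩q⁺ (x∈A , x∈B)))) x∉S
...   | inj₂ (x∉A , x∈S) | _ | no  x∉T = subst (x ∈_) △≡ (∈-△ˡ x∈S x∉T)
...   | inj₂ (x∉A , x∈S) | _ | yes x∈T =
  contradiction (p∩q⊆p A B (subst (x ∈_) ∩≡ (x∈p∩q⁺ (x∈S , x∈T)))) x∉A

module _ {M : SetSystem n ℓ} {A B : Subset n} where

  properSwap⇒¬peerless : ProperSwap M A B → ¬ IsPeerlessAntipode M A B
  properSwap⇒¬peerless (U , U⊆ , U≢⊥ , U≢D , M₁ , M₂) peerless
    with peerless (A △ U) (B △ U) M₁ M₂ (△-∩-invariant A B U⊆)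
           (solve 3 (λ A B U → A ⊕ U ⊕ (B ⊕ U) ⊜ A ⊕ B) refl A B U)
  ... | inj₁ (A△U≡A , _) = U≢⊥ (begin
    U            ≡⟨ solve 2 (λ A U → U ⊜ A ⊕ (A ⊕ U)) refl A U ⟩
    A △ (A △ U)  ≡⟨ cong (A △_) A△U≡A ⟩
    A △ A        ≡⟨ △-self A ⟩
    ⊥            ∎)
    where open ≡-Reasoning
  ... | inj₂ (A△U≡B , _) = U≢D (begin
    U            ≡⟨ solve 2 (λ A U → U ⊜ A ⊕ (A ⊕ U)) refl A U ⟩
    A △ (A △ U)  ≡⟨ cong (A △_) A△U≡B ⟩
    A △ B        ∎)
    where open ≡-Reasoning

  -- Opposite vertices lie in the interval, so isolation identifies `S`, and then `S △ T` determines
  -- `T`. One argument against peerless antipodes thereby covers all dimensions in the necessity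
  -- proof.
  isolated⇒peerless : IsIsolatedAntipode M A B → IsPeerlessAntipode M A B
  isolated⇒peerless isolated S T MS MT ∩≡ △≡
    with isolated S MS (subst (_⊆ S) ∩≡ (p∩q⊆p S T)) S⊆A∪B
    where
    S⊆A∪B : S ⊆ A ∪ B
    S⊆A∪B {x} x∈S with x ∈? A
    ... | yes x∈A = x∈p∪q⁺ (inj₁ x∈A)
    ... | no  x∉A with ∈-△⁻ (antipode⇒△-⊆ A B S T ∩≡ △≡ (∈-△ʳ x∉A x∈S))
    ...   | inj₁ (x∈A , _) = contradiction x∈A x∉A
    ...   | inj₂ (_ , x∈B) = x∈p∪q⁺ (inj₂ x∈B)
  ... | inj₁ refl = inj₁ (refl , (begin
    T            ≡⟨ solve 2 (λ S T → T ⊜ S ⊕ (S ⊕ T)) refl S T ⟩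
    S △ (S △ T)  ≡⟨ cong (S △_) △≡ ⟩
    S △ (S △ B)  ≡⟨ solve 2 (λ S B → S ⊕ (S ⊕ B) ⊜ B) refl S B ⟩
    B            ∎))
    where open ≡-Reasoning
  ... | inj₂ refl = inj₂ (refl , (begin
    T            ≡⟨ solve 2 (λ S T → T ⊜ S ⊕ (S ⊕ T)) refl S T ⟩
    S △ (S △ T)  ≡⟨ cong (S △_) △≡ ⟩
    S △ (A △ S)  ≡⟨ solve 2 (λ S A → S ⊕ (A ⊕ S) ⊜ A) refl S A ⟩
    A            ∎))
    where open ≡-Reasoning

module _ {M : SetSystem n ℓ} (M? : Decidable M) {k : ℕ} {A B : Subset n}
         (MA : M A) (MB : M B) (∣A△B∣≡k : ∣ A △ B ∣ ≡ k) where

  -- Decidability of `M` allows a search through all subsets for a swap, so the negated hypothesis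
  -- yields a witness.
  ¬peerless⇒properSwap : ¬ HasPeerlessAntipode M k → ProperSwap M A B
  ¬peerless⇒properSwap ¬peerless
    with anySubset? (λ U → U ⊆? (A △ B) ×-dec ¬? (U ≟ˢ ⊥) ×-dec ¬? (U ≟ˢ (A △ B))
                           ×-dec M? (A △ U) ×-dec M? (B △ U))
  ... | yes swap = swap
  ... | no ¬swap = contradiction (A , B , MA , MB , ∣A△B∣≡k , peerless) ¬peerless
    where
    peerless : IsPeerlessAntipode M A B
    peerless S T MS MT ∩≡ △≡ with (A △ S) ≟ˢ ⊥ | (A △ S) ≟ˢ (A △ B)
    ... | yes A△S≡⊥ | _ = inj₁ (sym A≡S , (begin
      T            ≡⟨ solve 2 (λ S T → T ⊜ S ⊕ (S ⊕ T)) refl S T ⟩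
      S △ (S △ T)  ≡⟨ cong₂ _△_ (sym A≡S) △≡ ⟩
      A △ (A △ B)  ≡⟨ solve 2 (λ A B → A ⊕ (A ⊕ B) ⊜ B) refl A B ⟩
      B            ∎))
      where
      open ≡-Reasoning
      A≡S = △≡⊥⇒≡ A△S≡⊥
    ... | _ | yes A△S≡A△B = inj₂ (S≡B , (begin
      T            ≡⟨ solve 2 (λ S T → T ⊜ S ⊕ (S ⊕ T)) refl S T ⟩
      S △ (S △ T)  ≡⟨ cong₂ _△_ S≡B △≡ ⟩
      B △ (A △ B)  ≡⟨ solve 2 (λ A B → B ⊕ (A ⊕ B) ⊜ A) refl A B ⟩
      A            ∎))
      where
      open ≡-Reasoning
      S≡B = begin
        S            ≡⟨ solve 2 (λ A S → S ⊜ A ⊕ (A ⊕ S)) refl A S ⟩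
        A △ (A △ S)  ≡⟨ cong (A △_) A△S≡A△B ⟩
        A △ (A △ B)  ≡⟨ solve 2 (λ A B → A ⊕ (A ⊕ B) ⊜ B) refl A B ⟩
        B            ∎
    -- A further opposite pair `S`, `T` is the swap along `A △ S`, since `B △ (A △ S)` is `T`.
    ... | no A△S≢⊥ | no A△S≢A△B = contradiction
      (A △ S , (λ {_} → antipode⇒△-⊆ A B S T ∩≡ △≡) , A△S≢⊥ , A△S≢A△B ,
       subst M (solve 2 (λ A S → S ⊜ A ⊕ (A ⊕ S)) refl A S) MS ,
       subst M T≡ MT) ¬swap
      where
      open ≡-Reasoning
      T≡ : T ≡ B △ (A △ S)
      T≡ = begin
        T            ≡⟨ solve 2 (λ S T → T ⊜ S ⊕ (S ⊕ T)) refl S T ⟩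
        S △ (S △ T)  ≡⟨ cong (S △_) △≡ ⟩
        S △ (A △ B)  ≡⟨ solve 3 (λ A B S → S ⊕ (A ⊕ B) ⊜ B ⊕ (A ⊕ S)) refl A B S ⟩
        B △ (A △ S)  ∎

  ¬isolated⇒between : ¬ HasIsolatedAntipode M k →
    ∃[ C ] M C × A △ C ⊆ A △ B × C ≢ A × C ≢ B
  ¬isolated⇒between ¬isolated
    with anySubset? (λ C → M? C ×-dec (A △ C) ⊆? (A △ B) ×-dec ¬? (C ≟ˢ A) ×-dec ¬? (C ≟ˢ B))
  ... | yes between = between
  ... | no ¬between = contradiction (A , B , MA , MB , ∣A△B∣≡k , isolated) ¬isolated
    where
    isolated : IsIsolatedAntipode M A B
    isolated S MS lower upper with S ≟ˢ A | S ≟ˢ B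
    ... | yes S≡A | _       = inj₁ S≡A
    ... | _       | yes S≡B = inj₂ S≡B
    ... | no S≢A  | no S≢B  =
      contradiction (S , MS , (λ {_} → interval⇒△-⊆ A B S lower upper) , S≢A , S≢B) ¬between

-- Exchange at distance three and four.

∉-△⁺ : x ∉ S → x ∉ T → x ∉ S △ T
∉-△⁺ x∉S x∉T x∈S△T with ∈-△⁻ x∈S△T
... | inj₁ (x∈S , _) = x∉S x∈S
... | inj₂ (_ , x∈T) = x∉T x∈T

∣⁅a,b,c⁆∣≡3 : a ≢ b → a ≢ c → b ≢ c → ∣ ⁅ a ⁆ △ ⁅ b ⁆ △ ⁅ c ⁆ ∣ ≡ 3
∣⁅a,b,c⁆∣≡3 {a = a} a≢b a≢c b≢c =
  trans (∣add∣ (∉-△⁺ (x≢y⇒x∉⁅y⁆ (≢-sym a≢c)) (x≢y⇒x∉⁅y⁆ (≢-sym b≢c))))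
    (cong suc (trans (∣add∣ (x≢y⇒x∉⁅y⁆ (≢-sym a≢b))) (cong suc (∣⁅x⁆∣≡1 a))))

∣⁅a,b,c,d⁆∣≡4 : a ≢ b → a ≢ c → a ≢ d → b ≢ c → b ≢ d → c ≢ d →
                ∣ ⁅ a ⁆ △ ⁅ b ⁆ △ ⁅ c ⁆ △ ⁅ d ⁆ ∣ ≡ 4
∣⁅a,b,c,d⁆∣≡4 a≢b a≢c a≢d b≢c b≢d c≢d =
  trans (∣add∣ (∉-△⁺ (∉-△⁺ (x≢y⇒x∉⁅y⁆ (≢-sym a≢d)) (x≢y⇒x∉⁅y⁆ (≢-sym b≢d))) (x≢y⇒x∉⁅y⁆ (≢-sym c≢d))))
    (cong suc (∣⁅a,b,c⁆∣≡3 a≢b a≢c b≢c))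

△-transfer : A △ B ≡ U △ V → A △ U ≡ B △ V
△-transfer {A = A} {B = B} {U = U} {V = V} D≡ = begin
  A △ U              ≡⟨ solve 3 (λ A B U → A ⊕ U ⊜ B ⊕ (A ⊕ B ⊕ U)) refl A B U ⟩
  B △ (A △ B △ U)    ≡⟨ cong (λ D → B △ (D △ U)) D≡ ⟩
  B △ (U △ V △ U)    ≡⟨ solve 3 (λ B U V → B ⊕ (U ⊕ V ⊕ U) ⊜ B ⊕ V) refl B U V ⟩
  B △ V              ∎
  where open ≡-Reasoning

module _ {M : SetSystem n ℓ} where

  sameSwap : U ≡ V → Swap M A B U → Swap M A B V
  sameSwap refl swap = swap

  -- Since `A △ U` is `B △ V` and `A △ V` is `B △ U`, both swaps produce the same two sets in
  -- opposite order. Hence `U` may be replaced by its complement in `A △ B`.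
  oppositeSwap : A △ B ≡ U △ V → Swap M A B U → Swap M A B V
  oppositeSwap {A = A} {B = B} D≡ (M₁ , M₂) =
    subst M (△-transfer (trans (△-comm B A) D≡)) M₂ , subst M (△-transfer D≡) M₁

PairSwap : SetSystem n ℓ → (A B : Subset n) → Fin n → Fin n → Set ℓ
PairSwap M A B a b = Swap M A B (⁅ a ⁆ △ ⁅ b ⁆)

module LocalExchange {M : SetSystem n ℓ} (M? : Decidable M)
  (¬peerless₃ : ¬ HasPeerlessAntipode M 3) (¬peerless₄ : ¬ HasPeerlessAntipode M 4) where

  -- A proper nonempty subset of three elements is a singleton or the complement of one, and
  -- `oppositeSwap` reduces the latter to the former.
  exchange₃ : M A → M B → A △ B ≡ ⁅ b ⁆ △ ⁅ c ⁆ △ ⁅ d ⁆ → b ≢ c → b ≢ d → c ≢ d →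
              Any (λ i → Swap M A B ⁅ i ⁆) (b ∷ c ∷ d ∷ [])
  exchange₃ {A = A} {B = B} {b = b} {c = c} {d = d} MA MB D≡ b≢c b≢d c≢d
    with ¬peerless⇒properSwap M? MA MB (trans (cong ∣_∣ D≡) (∣⁅a,b,c⁆∣≡3 b≢c b≢d c≢d)) ¬peerless₃
  ... | U , U⊆D , U≢⊥ , U≢D , swap
    with ⊆-select (b ∷ c ∷ d ∷ []) (λ {x} → subst (x ∈_)
      (trans D≡ (solve 3 (λ b c d → b ⊕ c ⊕ d ⊜ b ⊕ (c ⊕ (d ⊕ ∅))) refl ⁅ b ⁆ ⁅ c ⁆ ⁅ d ⁆)) ∘ U⊆D)
  ... | false ∷ false ∷ false ∷ [] , refl = contradiction refl U≢⊥
  ... | true  ∷ false ∷ false ∷ [] , refl = here (sameSwap {M = M} (△-identityʳ _) swap)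
  ... | false ∷ true  ∷ false ∷ [] , refl = there (here (sameSwap {M = M} (△-identityʳ _) swap))
  ... | false ∷ false ∷ true  ∷ [] , refl = there (there (here (sameSwap {M = M} (△-identityʳ _) swap)))
  ... | true  ∷ true  ∷ false ∷ [] , refl = there (there (here (oppositeSwap {M = M} (trans D≡
    (solve 3 (λ b c d → b ⊕ c ⊕ d ⊜ b ⊕ (c ⊕ ∅) ⊕ d) refl ⁅ b ⁆ ⁅ c ⁆ ⁅ d ⁆)) swap)))
  ... | true  ∷ false ∷ true  ∷ [] , refl = there (here (oppositeSwap {M = M} (trans D≡
    (solve 3 (λ b c d → b ⊕ c ⊕ d ⊜ b ⊕ (d ⊕ ∅) ⊕ c) refl ⁅ b ⁆ ⁅ c ⁆ ⁅ d ⁆)) swap))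
  ... | false ∷ true  ∷ true  ∷ [] , refl = here (oppositeSwap {M = M} (trans D≡
    (solve 3 (λ b c d → b ⊕ c ⊕ d ⊜ c ⊕ (d ⊕ ∅) ⊕ b) refl ⁅ b ⁆ ⁅ c ⁆ ⁅ d ⁆)) swap)
  ... | true  ∷ true  ∷ true  ∷ [] , refl = contradiction (trans
    (solve 3 (λ b c d → b ⊕ (c ⊕ (d ⊕ ∅)) ⊜ b ⊕ c ⊕ d) refl ⁅ b ⁆ ⁅ c ⁆ ⁅ d ⁆) (sym D≡)) U≢D

  -- Exchange between A △ {j} and B, and if need be between A and B △ {i}, either
  -- completes one of the two given half swaps or swaps the complementary pair.
  crossing⇒pairSwap : {a i j k : Fin n} → M A → M B → A △ B ≡ ⁅ a ⁆ △ ⁅ i ⁆ △ ⁅ j ⁆ △ ⁅ k ⁆ →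
    a ≢ i → a ≢ j → a ≢ k → i ≢ j → i ≢ k → j ≢ k →
    M (A △ ⁅ j ⁆) → M (B △ ⁅ i ⁆) → M (A △ (⁅ a ⁆ △ ⁅ i ⁆)) → M (B △ (⁅ a ⁆ △ ⁅ j ⁆)) →
    Any (PairSwap M A B a) (i ∷ j ∷ k ∷ [])
  crossing⇒pairSwap {A = A} {B = B} {a = a} {i = i} {j = j} {k = k}
    MA MB D≡ a≢i a≢j a≢k i≢j i≢k j≢k MAj MBi MAai MBaj
    with exchange₃ MAj MB D₁≡ a≢i a≢k i≢k
    where
    D₁≡ : A △ ⁅ j ⁆ △ B ≡ ⁅ a ⁆ △ ⁅ i ⁆ △ ⁅ k ⁆
    D₁≡ = begin
      A △ ⁅ j ⁆ △ B    ≡⟨ solve 3 (λ A B j → A ⊕ j ⊕ B ⊜ A ⊕ B ⊕ j) refl A B ⁅ j ⁆ ⟩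
      A △ B △ ⁅ j ⁆    ≡⟨ cong (_△ ⁅ j ⁆) D≡ ⟩
      ⁅ a ⁆ △ ⁅ i ⁆ △ ⁅ j ⁆ △ ⁅ k ⁆ △ ⁅ j ⁆
        ≡⟨ solve 4 (λ a i j k → a ⊕ i ⊕ j ⊕ k ⊕ j ⊜ a ⊕ i ⊕ k) refl ⁅ a ⁆ ⁅ i ⁆ ⁅ j ⁆ ⁅ k ⁆ ⟩
      ⁅ a ⁆ △ ⁅ i ⁆ △ ⁅ k ⁆ ∎
      where open ≡-Reasoning
  ... | here (MAja , _) = there (here
    (subst M (solve 3 (λ A j a → A ⊕ j ⊕ a ⊜ A ⊕ (a ⊕ j)) refl A ⁅ j ⁆ ⁅ a ⁆) MAja , MBaj))
  ... | there (there (here (MAjk , _))) = here (MAai , subst M (trans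
    (△-assoc A _ _) (△-transfer (trans D≡ (solve 4 (λ a i j k → a ⊕ i ⊕ j ⊕ k ⊜ j ⊕ k ⊕ (a ⊕ i))
      refl ⁅ a ⁆ ⁅ i ⁆ ⁅ j ⁆ ⁅ k ⁆)))) MAjk)
  ... | there (here (MAji , _)) with exchange₃ MA MBi D₂≡ a≢j a≢k j≢k
    where
    D₂≡ : A △ (B △ ⁅ i ⁆) ≡ ⁅ a ⁆ △ ⁅ j ⁆ △ ⁅ k ⁆
    D₂≡ = begin
      A △ (B △ ⁅ i ⁆)  ≡⟨ △-assoc A B ⁅ i ⁆ ⟨
      A △ B △ ⁅ i ⁆    ≡⟨ cong (_△ ⁅ i ⁆) D≡ ⟩
      ⁅ a ⁆ △ ⁅ i ⁆ △ ⁅ j ⁆ △ ⁅ k ⁆ △ ⁅ i ⁆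
        ≡⟨ solve 4 (λ a i j k → a ⊕ i ⊕ j ⊕ k ⊕ i ⊜ a ⊕ j ⊕ k) refl ⁅ a ⁆ ⁅ i ⁆ ⁅ j ⁆ ⁅ k ⁆ ⟩
      ⁅ a ⁆ △ ⁅ j ⁆ △ ⁅ k ⁆ ∎
      where open ≡-Reasoning
  ...   | here (_ , MBia) = here
    (MAai , subst M (solve 3 (λ B i a → B ⊕ i ⊕ a ⊜ B ⊕ (a ⊕ i)) refl B ⁅ i ⁆ ⁅ a ⁆) MBia)
  ...   | there (here (_ , MBij)) = there (there (here (oppositeSwap {M = M} {U = ⁅ i ⁆ △ ⁅ j ⁆}
    (trans D≡ (solve 4 (λ a i j k → a ⊕ i ⊕ j ⊕ k ⊜ i ⊕ j ⊕ (a ⊕ k)) refl ⁅ a ⁆ ⁅ i ⁆ ⁅ j ⁆ ⁅ k ⁆))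
    ( subst M (solve 3 (λ A i j → A ⊕ j ⊕ i ⊜ A ⊕ (i ⊕ j)) refl A ⁅ i ⁆ ⁅ j ⁆) MAji
    , subst M (△-assoc B _ _) MBij))))
  ...   | there (there (here (_ , MBik))) = there (here (subst M (trans
    (△-assoc B _ _) (△-transfer (trans (△-comm B A) (trans D≡
      (solve 4 (λ a i j k → a ⊕ i ⊕ j ⊕ k ⊜ i ⊕ k ⊕ (a ⊕ j)) refl ⁅ a ⁆ ⁅ i ⁆ ⁅ j ⁆ ⁅ k ⁆))))) MBik
    , MBaj))

  -- Exchange between `A △ {a}` and `B` gives an `i` with `A △ {a, i}` and `B △ {i}` feasible;
  -- exchange between `A` and `B △ {a}` gives a `j` with `A △ {j}` and `B △ {a, j}` feasible. If `i`
  -- equals `j`, this is a pair swap; otherwise `crossing⇒pairSwap` applies. The six mixed cases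
  -- differ by a permutation of `b`, `c`, `d`.
  single⇒pairSwap : M A → M B → A △ B ≡ ⁅ a ⁆ △ ⁅ b ⁆ △ ⁅ c ⁆ △ ⁅ d ⁆ →
    a ≢ b → a ≢ c → a ≢ d → b ≢ c → b ≢ d → c ≢ d →
    Swap M A B ⁅ a ⁆ → Any (PairSwap M A B a) (b ∷ c ∷ d ∷ [])
  single⇒pairSwap {A = A} {B = B} {a = a} {b = b} {c = c} {d = d}
    MA MB D≡ a≢b a≢c a≢d b≢c b≢d c≢d (MAa , MBa)
    with exchange₃ MAa MB D₁≡ b≢c b≢d c≢d | exchange₃ MA MBa D₂≡ b≢c b≢d c≢d
    where
    D₁≡ : A △ ⁅ a ⁆ △ B ≡ ⁅ b ⁆ △ ⁅ c ⁆ △ ⁅ d ⁆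
    D₁≡ = begin
      A △ ⁅ a ⁆ △ B    ≡⟨ solve 3 (λ A B a → A ⊕ a ⊕ B ⊜ A ⊕ B ⊕ a) refl A B ⁅ a ⁆ ⟩
      A △ B △ ⁅ a ⁆    ≡⟨ cong (_△ ⁅ a ⁆) D≡ ⟩
      ⁅ a ⁆ △ ⁅ b ⁆ △ ⁅ c ⁆ △ ⁅ d ⁆ △ ⁅ a ⁆
        ≡⟨ solve 4 (λ a b c d → a ⊕ b ⊕ c ⊕ d ⊕ a ⊜ b ⊕ c ⊕ d) refl ⁅ a ⁆ ⁅ b ⁆ ⁅ c ⁆ ⁅ d ⁆ ⟩
      ⁅ b ⁆ △ ⁅ c ⁆ △ ⁅ d ⁆ ∎
      where open ≡-Reasoning
    D₂≡ : A △ (B △ ⁅ a ⁆) ≡ ⁅ b ⁆ △ ⁅ c ⁆ △ ⁅ d ⁆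
    D₂≡ = trans (solve 3 (λ A B a → A ⊕ (B ⊕ a) ⊜ A ⊕ a ⊕ B) refl A B ⁅ a ⁆) D₁≡
  ... | here (MAab , MBb) | here (MAb , MBab) =
    here (subst M (△-assoc A _ _) MAab , subst M (△-assoc B _ _) MBab)
  ... | there (here (MAac , MBc)) | there (here (MAc , MBac)) =
    there (here (subst M (△-assoc A _ _) MAac , subst M (△-assoc B _ _) MBac))
  ... | there (there (here (MAad , MBd))) | there (there (here (MAd , MBad))) =
    there (there (here (subst M (△-assoc A _ _) MAad , subst M (△-assoc B _ _) MBad)))
  ... | here (MAab , MBb) | there (here (MAc , MBac)) =
    crossing⇒pairSwap MA MB D≡
      a≢b a≢c a≢d b≢c b≢d c≢d MAc MBb
      (subst M (△-assoc A _ _) MAab) (subst M (△-assoc B _ _) MBac)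
  ... | here (MAab , MBb) | there (there (here (MAd , MBad))) =
    Any-resp-↭ (↭.prep b (↭.swap d c ↭.refl))
      (crossing⇒pairSwap MA MB (trans D≡
        (solve 4 (λ a b c d → a ⊕ b ⊕ c ⊕ d ⊜ a ⊕ b ⊕ d ⊕ c)
          refl ⁅ a ⁆ ⁅ b ⁆ ⁅ c ⁆ ⁅ d ⁆))
      a≢b a≢d a≢c b≢d b≢c (≢-sym c≢d) MAd MBb
      (subst M (△-assoc A _ _) MAab) (subst M (△-assoc B _ _) MBad))
  ... | there (here (MAac , MBc)) | here (MAb , MBab) =
    Any-resp-↭ (↭.swap c b ↭.refl)
      (crossing⇒pairSwap MA MB (trans D≡
        (solve 4 (λ a b c d → a ⊕ b ⊕ c ⊕ d ⊜ a ⊕ c ⊕ b ⊕ d)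
          refl ⁅ a ⁆ ⁅ b ⁆ ⁅ c ⁆ ⁅ d ⁆))
      a≢c a≢b a≢d (≢-sym b≢c) c≢d b≢d MAb MBc
      (subst M (△-assoc A _ _) MAac) (subst M (△-assoc B _ _) MBab))
  ... | there (here (MAac , MBc)) | there (there (here (MAd , MBad))) =
    Any-resp-↭ (↭.trans (↭.prep c (↭.swap d b ↭.refl)) (↭.swap c b ↭.refl))
      (crossing⇒pairSwap MA MB (trans D≡
        (solve 4 (λ a b c d → a ⊕ b ⊕ c ⊕ d ⊜ a ⊕ c ⊕ d ⊕ b)
          refl ⁅ a ⁆ ⁅ b ⁆ ⁅ c ⁆ ⁅ d ⁆))
      a≢c a≢d a≢b c≢d (≢-sym b≢c) (≢-sym b≢d) MAd MBc
      (subst M (△-assoc A _ _) MAac) (subst M (△-assoc B _ _) MBad))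
  ... | there (there (here (MAad , MBd))) | here (MAb , MBab) =
    Any-resp-↭ (↭.trans (↭.swap d b ↭.refl) (↭.prep b (↭.swap d c ↭.refl)))
      (crossing⇒pairSwap MA MB (trans D≡
        (solve 4 (λ a b c d → a ⊕ b ⊕ c ⊕ d ⊜ a ⊕ d ⊕ b ⊕ c)
          refl ⁅ a ⁆ ⁅ b ⁆ ⁅ c ⁆ ⁅ d ⁆))
      a≢d a≢b a≢c (≢-sym b≢d) (≢-sym c≢d) b≢c MAb MBd
      (subst M (△-assoc A _ _) MAad) (subst M (△-assoc B _ _) MBab))
  ... | there (there (here (MAad , MBd))) | there (here (MAc , MBac)) =
    Any-resp-↭ (↭.trans (↭.swap d c ↭.refl) (↭.trans (↭.prep c (↭.swap d b ↭.refl)) (↭.swap c b ↭.refl)))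
      (crossing⇒pairSwap MA MB (trans D≡
        (solve 4 (λ a b c d → a ⊕ b ⊕ c ⊕ d ⊜ a ⊕ d ⊕ c ⊕ b)
          refl ⁅ a ⁆ ⁅ b ⁆ ⁅ c ⁆ ⁅ d ⁆))
      a≢d a≢c a≢b (≢-sym c≢d) (≢-sym b≢d) (≢-sym b≢c) MAc MBd
      (subst M (△-assoc A _ _) MAad) (subst M (△-assoc B _ _) MBac))

  -- A proper swap has one, two or three elements. By complementation a pair may be assumed to
  -- contain `a`, and a triple becomes a singleton. Then `single⇒pairSwap` turns a singleton into a
  -- pair, which may need to be complemented in turn.
  exchange₄ : M A → M B → A △ B ≡ ⁅ a ⁆ △ ⁅ b ⁆ △ ⁅ c ⁆ △ ⁅ d ⁆ →
    a ≢ b → a ≢ c → a ≢ d → b ≢ c → b ≢ d → c ≢ d →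
    Any (PairSwap M A B a) (b ∷ c ∷ d ∷ [])
  exchange₄ {A = A} {B = B} {a = a} {b = b} {c = c} {d = d}
    MA MB D≡ a≢b a≢c a≢d b≢c b≢d c≢d
    with ¬peerless⇒properSwap M? MA MB
           (trans (cong ∣_∣ D≡) (∣⁅a,b,c,d⁆∣≡4 a≢b a≢c a≢d b≢c b≢d c≢d)) ¬peerless₄
  ... | U , U⊆D , U≢⊥ , U≢D , swapU
    with ⊆-select (a ∷ b ∷ c ∷ d ∷ []) (λ {x} → subst (x ∈_) (trans D≡
           (solve 4 (λ a b c d → a ⊕ b ⊕ c ⊕ d ⊜ a ⊕ (b ⊕ (c ⊕ (d ⊕ ∅)))) refl ⁅ a ⁆ ⁅ b ⁆ ⁅ c ⁆ ⁅ d ⁆)) ∘ U⊆D)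
  ... | bs , U≡ = byCases bs U≡
    where
    Goal : Set ℓ
    Goal = Any (PairSwap M A B a) (b ∷ c ∷ d ∷ [])

    from-ab : Swap M A B (⁅ a ⁆ △ ⁅ b ⁆) → Goal
    from-ab s = here s
    from-ac : Swap M A B (⁅ a ⁆ △ ⁅ c ⁆) → Goal
    from-ac s = there (here s)
    from-ad : Swap M A B (⁅ a ⁆ △ ⁅ d ⁆) → Goal
    from-ad s = there (there (here s))
    from-bc : Swap M A B (⁅ b ⁆ △ ⁅ c ⁆) → Goal
    from-bc = from-ad ∘ oppositeSwap {M = M} (trans D≡
      (solve 4 (λ a b c d → a ⊕ b ⊕ c ⊕ d ⊜ b ⊕ c ⊕ (a ⊕ d)) refl ⁅ a ⁆ ⁅ b ⁆ ⁅ c ⁆ ⁅ d ⁆))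
    from-bd : Swap M A B (⁅ b ⁆ △ ⁅ d ⁆) → Goal
    from-bd = from-ac ∘ oppositeSwap {M = M} (trans D≡
      (solve 4 (λ a b c d → a ⊕ b ⊕ c ⊕ d ⊜ b ⊕ d ⊕ (a ⊕ c)) refl ⁅ a ⁆ ⁅ b ⁆ ⁅ c ⁆ ⁅ d ⁆))
    from-cd : Swap M A B (⁅ c ⁆ △ ⁅ d ⁆) → Goal
    from-cd = from-ab ∘ oppositeSwap {M = M} (trans D≡
      (solve 4 (λ a b c d → a ⊕ b ⊕ c ⊕ d ⊜ c ⊕ d ⊕ (a ⊕ b)) refl ⁅ a ⁆ ⁅ b ⁆ ⁅ c ⁆ ⁅ d ⁆))

    pair-comm : ∀ x y → Swap M A B (⁅ y ⁆ △ ⁅ x ⁆) → Swap M A B (⁅ x ⁆ △ ⁅ y ⁆)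
    pair-comm x y = sameSwap {M = M} (△-comm ⁅ y ⁆ ⁅ x ⁆)

    from-a : Swap M A B ⁅ a ⁆ → Goal
    from-a = single⇒pairSwap MA MB D≡ a≢b a≢c a≢d b≢c b≢d c≢d

    from-b : Swap M A B ⁅ b ⁆ → Goal
    from-b swap-b with single⇒pairSwap MA MB (trans D≡
      (solve 4 (λ a b c d → a ⊕ b ⊕ c ⊕ d ⊜ b ⊕ a ⊕ c ⊕ d) refl ⁅ a ⁆ ⁅ b ⁆ ⁅ c ⁆ ⁅ d ⁆))
      (≢-sym a≢b) b≢c b≢d a≢c a≢d c≢d swap-b
    ... | here s = from-ab (pair-comm a b s)
    ... | there (here s) = from-bc s
    ... | there (there (here s)) = from-bd s

    from-c : Swap M A B ⁅ c ⁆ → Goal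
    from-c swap-c with single⇒pairSwap MA MB (trans D≡
      (solve 4 (λ a b c d → a ⊕ b ⊕ c ⊕ d ⊜ c ⊕ a ⊕ b ⊕ d) refl ⁅ a ⁆ ⁅ b ⁆ ⁅ c ⁆ ⁅ d ⁆))
      (≢-sym a≢c) (≢-sym b≢c) c≢d a≢b a≢d b≢d swap-c
    ... | here s = from-ac (pair-comm a c s)
    ... | there (here s) = from-bc (pair-comm b c s)
    ... | there (there (here s)) = from-cd s

    from-d : Swap M A B ⁅ d ⁆ → Goal
    from-d swap-d with single⇒pairSwap MA MB (trans D≡
      (solve 4 (λ a b c d → a ⊕ b ⊕ c ⊕ d ⊜ d ⊕ a ⊕ b ⊕ c) refl ⁅ a ⁆ ⁅ b ⁆ ⁅ c ⁆ ⁅ d ⁆))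
      (≢-sym a≢d) (≢-sym b≢d) (≢-sym c≢d) a≢b a≢c b≢c swap-d
    ... | here s = from-ad (pair-comm a d s)
    ... | there (here s) = from-bd (pair-comm b d s)
    ... | there (there (here s)) = from-cd (pair-comm c d s)

    byCases : ∀ bs → U ≡ select bs (map ⁅_⁆ (a ∷ b ∷ c ∷ d ∷ [])) → Goal
    byCases (false ∷ false ∷ false ∷ false ∷ []) U≡ = contradiction U≡ U≢⊥
    byCases (false ∷ false ∷ false ∷ true  ∷ []) U≡ =
      from-d (sameSwap {M = M} (trans U≡ (△-identityʳ _)) swapU)
    byCases (false ∷ false ∷ true  ∷ false ∷ []) U≡ =
      from-c (sameSwap {M = M} (trans U≡ (△-identityʳ _)) swapU)
    byCases (false ∷ false ∷ true  ∷ true  ∷ []) U≡ =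
      from-cd (sameSwap {M = M} (trans U≡ (cong (⁅ c ⁆ △_) (△-identityʳ _))) swapU)
    byCases (false ∷ true  ∷ false ∷ false ∷ []) U≡ =
      from-b (sameSwap {M = M} (trans U≡ (△-identityʳ _)) swapU)
    byCases (false ∷ true  ∷ false ∷ true  ∷ []) U≡ =
      from-bd (sameSwap {M = M} (trans U≡ (cong (⁅ b ⁆ △_) (△-identityʳ _))) swapU)
    byCases (false ∷ true  ∷ true  ∷ false ∷ []) U≡ =
      from-bc (sameSwap {M = M} (trans U≡ (cong (⁅ b ⁆ △_) (△-identityʳ _))) swapU)
    byCases (false ∷ true  ∷ true  ∷ true  ∷ []) U≡ =
      from-a (oppositeSwap {M = M} (trans D≡ (trans
      (solve 4 (λ a b c d → a ⊕ b ⊕ c ⊕ d ⊜ b ⊕ (c ⊕ (d ⊕ ∅)) ⊕ a) refl ⁅ a ⁆ ⁅ b ⁆ ⁅ c ⁆ ⁅ d ⁆)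
      (cong (_△ ⁅ a ⁆) (sym U≡)))) swapU)
    byCases (true  ∷ false ∷ false ∷ false ∷ []) U≡ =
      from-a (sameSwap {M = M} (trans U≡ (△-identityʳ _)) swapU)
    byCases (true  ∷ false ∷ false ∷ true  ∷ []) U≡ =
      from-ad (sameSwap {M = M} (trans U≡ (cong (⁅ a ⁆ △_) (△-identityʳ _))) swapU)
    byCases (true  ∷ false ∷ true  ∷ false ∷ []) U≡ =
      from-ac (sameSwap {M = M} (trans U≡ (cong (⁅ a ⁆ △_) (△-identityʳ _))) swapU)
    byCases (true  ∷ false ∷ true  ∷ true  ∷ []) U≡ =
      from-b (oppositeSwap {M = M} (trans D≡ (trans
      (solve 4 (λ a b c d → a ⊕ b ⊕ c ⊕ d ⊜ a ⊕ (c ⊕ (d ⊕ ∅)) ⊕ b) refl ⁅ a ⁆ ⁅ b ⁆ ⁅ c ⁆ ⁅ d ⁆)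
      (cong (_△ ⁅ b ⁆) (sym U≡)))) swapU)
    byCases (true  ∷ true  ∷ false ∷ false ∷ []) U≡ =
      from-ab (sameSwap {M = M} (trans U≡ (cong (⁅ a ⁆ △_) (△-identityʳ _))) swapU)
    byCases (true  ∷ true  ∷ false ∷ true  ∷ []) U≡ =
      from-c (oppositeSwap {M = M} (trans D≡ (trans
      (solve 4 (λ a b c d → a ⊕ b ⊕ c ⊕ d ⊜ a ⊕ (b ⊕ (d ⊕ ∅)) ⊕ c) refl ⁅ a ⁆ ⁅ b ⁆ ⁅ c ⁆ ⁅ d ⁆)
      (cong (_△ ⁅ c ⁆) (sym U≡)))) swapU)
    byCases (true  ∷ true  ∷ true  ∷ false ∷ []) U≡ =
      from-d (oppositeSwap {M = M} (trans D≡ (trans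
      (solve 4 (λ a b c d → a ⊕ b ⊕ c ⊕ d ⊜ a ⊕ (b ⊕ (c ⊕ ∅)) ⊕ d) refl ⁅ a ⁆ ⁅ b ⁆ ⁅ c ⁆ ⁅ d ⁆)
      (cong (_△ ⁅ d ⁆) (sym U≡)))) swapU)
    byCases (true  ∷ true  ∷ true  ∷ true  ∷ []) U≡ = contradiction (trans U≡ (trans
      (solve 4 (λ a b c d → a ⊕ (b ⊕ (c ⊕ (d ⊕ ∅))) ⊜ a ⊕ b ⊕ c ⊕ d) refl ⁅ a ⁆ ⁅ b ⁆ ⁅ c ⁆ ⁅ d ⁆) (sym D≡))) U≢D

-- Simultaneous exchange by a graph argument.

Exchangeable : SetSystem n ℓ → Subset n → Subset n → Set ℓ
Exchangeable K A B = ∀ {a} → a ∈ A △ B → ∃[ b ] b ∈ A △ B × b ≢ a × PairSwap K A B a b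

LocallyExchangeable : SetSystem n ℓ → Set ℓ
LocallyExchangeable K = ∀ {A B a b c d} → K A → K B →
  A △ B ≡ ⁅ a ⁆ △ ⁅ b ⁆ △ ⁅ c ⁆ △ ⁅ d ⁆ →
  a ≢ b → a ≢ c → a ≢ d → b ≢ c → b ≢ d → c ≢ d →
  Any (PairSwap K A B a) (b ∷ c ∷ d ∷ [])

ExchangeableBelow : SetSystem n ℓ → Subset n → Set ℓ
ExchangeableBelow K D = ∀ {A B} → K A → K B → A △ B ⊂ D → Exchangeable K A B

∈-remove₂⁺ : x ∈ S → x ≢ a → x ≢ b → x ∈ S △ ⁅ a ⁆ △ ⁅ b ⁆
∈-remove₂⁺ x∈S x≢a = ∈-remove⁺ (∈-remove⁺ x∈S x≢a)

∈-remove₂⁻ : a ∈ S → b ∈ S → a ≢ b → x ∈ S △ ⁅ a ⁆ △ ⁅ b ⁆ → x ∈ S × x ≢ a × x ≢ b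
∈-remove₂⁻ a∈S b∈S a≢b x∈ with ∈-remove⁻ (∈-remove⁺ b∈S (≢-sym a≢b)) x∈
... | x∈S△a , x≢b with ∈-remove⁻ a∈S x∈S△a
...   | x∈S , x≢a = x∈S , x≢a , x≢b

pair-comm : {K : SetSystem n ℓ} (a b : Fin n) → K (A △ (⁅ a ⁆ △ ⁅ b ⁆)) → K (A △ (⁅ b ⁆ △ ⁅ a ⁆))
pair-comm {A = A} {K = K} a b = subst (K ∘ (A △_)) (△-comm ⁅ a ⁆ ⁅ b ⁆)

module Exchange {K : SetSystem n ℓ} (exchange₄ : LocallyExchangeable K)
                {D : Subset n} (below : ExchangeableBelow K D) where

  -- Edge A is the graph on D whose edges are the pairs {a, b} with
  -- A △ {a, b} feasible. The lemma swing says that it is complete multipartite,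
  -- unless it shares an edge with Edge B.
  Edge : Subset n → Fin n → Fin n → Set ℓ
  Edge A a b = K (A △ (⁅ a ⁆ △ ⁅ b ⁆))

  -- The set `A △ {c, e}` is feasible and nearer to `B`, so exchange between these two supplies `f`.
  -- Now `A` and `A △ {a, c, e, f}` are feasible at distance four, and the partner of `a` between
  -- them, namely `f`, `c` or `e`, gives the three alternatives.
  swing : K A → K B → A △ B ≡ D → c ∈ D → e ∈ D → c ≢ e → Edge A c e →
    a ∈ D → a ≢ c → a ≢ e →
    ∃[ f ] (f ∈ D × f ≢ a × f ≢ c × f ≢ e) × Edge B a f ×
      (Edge A a f ⊎ (Edge A a c × Edge A e f) ⊎ (Edge A a e × Edge A c f))
  swing {A = A} {B = B} {c = c} {e = e} {a = a} KA KB refl c∈D e∈D c≢e KAce a∈D a≢c a≢e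
    with below KAce KB (⊆D , c , c∈D , c∉) a∈D′
    where
    D≡ : A △ (⁅ c ⁆ △ ⁅ e ⁆) △ B ≡ A △ B △ ⁅ c ⁆ △ ⁅ e ⁆
    D≡ = solve 4 (λ A B c e → A ⊕ (c ⊕ e) ⊕ B ⊜ A ⊕ B ⊕ c ⊕ e) refl A B ⁅ c ⁆ ⁅ e ⁆

    ⊆D : A △ (⁅ c ⁆ △ ⁅ e ⁆) △ B ⊆ A △ B
    ⊆D x∈ = proj₁ (∈-remove₂⁻ c∈D e∈D c≢e (subst (_ ∈_) D≡ x∈))

    c∉ : c ∉ A △ (⁅ c ⁆ △ ⁅ e ⁆) △ B
    c∉ c∈ = proj₁ (proj₂ (∈-remove₂⁻ c∈D e∈D c≢e (subst (_ ∈_) D≡ c∈))) refl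

    a∈D′ : a ∈ A △ (⁅ c ⁆ △ ⁅ e ⁆) △ B
    a∈D′ = subst (a ∈_) (sym D≡) (∈-remove₂⁺ a∈D a≢c a≢e)
  ... | f , f∈D′ , f≢a , KAceaf , KBaf
    with ∈-remove₂⁻ c∈D e∈D c≢e (subst (f ∈_)
           (solve 4 (λ A B c e → A ⊕ (c ⊕ e) ⊕ B ⊜ A ⊕ B ⊕ c ⊕ e) refl A B ⁅ c ⁆ ⁅ e ⁆) f∈D′)
  ... | f∈D , f≢c , f≢e = f , (f∈D , f≢a , f≢c , f≢e) , KBaf , swung
    (exchange₄ KA KAceaf
      (solve 5 (λ A a c e f → A ⊕ (A ⊕ (c ⊕ e) ⊕ (a ⊕ f)) ⊜ a ⊕ c ⊕ e ⊕ f) refl A ⁅ a ⁆ ⁅ c ⁆ ⁅ e ⁆ ⁅ f ⁆)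
      a≢c a≢e (≢-sym f≢a) c≢e (≢-sym f≢c) (≢-sym f≢e))
    where
    swung : Any (PairSwap K A (A △ (⁅ c ⁆ △ ⁅ e ⁆) △ (⁅ a ⁆ △ ⁅ f ⁆)) a) (c ∷ e ∷ f ∷ []) →
            Edge A a f ⊎ (Edge A a c × Edge A e f) ⊎ (Edge A a e × Edge A c f)
    swung (here (KAac , KAef)) = inj₂ (inj₁ (KAac , subst K
      (solve 5 (λ A a c e f → A ⊕ (c ⊕ e) ⊕ (a ⊕ f) ⊕ (a ⊕ c) ⊜ A ⊕ (e ⊕ f)) refl A ⁅ a ⁆ ⁅ c ⁆ ⁅ e ⁆ ⁅ f ⁆) KAef))
    swung (there (here (KAae , KAcf))) = inj₂ (inj₂ (KAae , subst K
      (solve 5 (λ A a c e f → A ⊕ (c ⊕ e) ⊕ (a ⊕ f) ⊕ (a ⊕ e) ⊜ A ⊕ (c ⊕ f)) refl A ⁅ a ⁆ ⁅ c ⁆ ⁅ e ⁆ ⁅ f ⁆) KAcf))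
    swung (there (there (here (KAaf , _)))) = inj₁ KAaf

  CommonEdge : Subset n → Subset n → Set ℓ
  CommonEdge A B = ∃[ p ] ∃[ q ] p ∈ D × q ∈ D × p ≢ q × Edge A p q × Edge B p q

  -- In a complete multipartite graph with an edge no vertex is isolated: swinging the edge to `x`
  -- joins `x` to one of its ends, unless a common edge appears.
  neighbour : K A → K B → A △ B ≡ D → c ∈ D → e ∈ D → c ≢ e → Edge A c e → x ∈ D →
    CommonEdge A B ⊎ (∃[ z ] z ∈ D × z ≢ x × Edge A x z)
  neighbour {A = A} {c = c} {e = e} {x = x} KA KB D≡ c∈D e∈D c≢e KAce x∈D with x ≟ c | x ≟ e
  ... | yes refl | _        = inj₂ (e , e∈D , ≢-sym c≢e , KAce)
  ... | no  _    | yes refl = inj₂ (c , c∈D , c≢e , pair-comm {A = A} {K = K} c e KAce)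
  ... | no  x≢c  | no  x≢e  with swing KA KB D≡ c∈D e∈D c≢e KAce x∈D x≢c x≢e
  ...   | f , (f∈D , f≢x , _) , KBxf , inj₁ KAxf = inj₁ (x , f , x∈D , f∈D , ≢-sym f≢x , KAxf , KBxf)
  ...   | _ , _ , _ , inj₂ (inj₁ (KAxc , _)) = inj₂ (c , c∈D , ≢-sym x≢c , KAxc)
  ...   | _ , _ , _ , inj₂ (inj₂ (KAxe , _)) = inj₂ (e , e∈D , ≢-sym x≢e , KAxe)

  -- Let `z` be a neighbour of `x` in `Edge A`. Swinging this edge to `y` leaves, besides outcomes
  -- with a common edge, only the case that `z` is joined to both `x` and `y` in `Edge A`. Swinging
  -- the edge between `x` and `y` in `Edge B` to `z` then joins `z` to one of them there, or again
  -- gives a common edge directly.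
  commonEdge : K A → K B → A △ B ≡ D →
    c ∈ D → e ∈ D → c ≢ e → Edge A c e → x ∈ D → y ∈ D → x ≢ y → Edge B x y → CommonEdge A B
  commonEdge {A = A} {B = B} {x = x} {y = y} KA KB D≡ c∈D e∈D c≢e KAce x∈D y∈D x≢y KBxy
    with neighbour KA KB D≡ c∈D e∈D c≢e KAce x∈D
  ... | inj₁ common = common
  ... | inj₂ (z , z∈D , z≢x , KAxz) with y ≟ z
  ...   | yes refl = x , y , x∈D , y∈D , x≢y , KAxz , KBxy
  ...   | no  y≢z with swing KA KB D≡ x∈D z∈D (≢-sym z≢x) KAxz y∈D (≢-sym x≢y) y≢z
  ...     | f , (f∈D , f≢y , _) , KByf , inj₁ KAyf = y , f , y∈D , f∈D , ≢-sym f≢y , KAyf , KByf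
  ...     | _ , _ , _ , inj₂ (inj₁ (KAyx , _)) = x , y , x∈D , y∈D , x≢y , pair-comm {A = A} {K = K} y x KAyx , KBxy
  ...     | _ , _ , _ , inj₂ (inj₂ (KAyz , _))
    with swing KB KA (trans (△-comm B A) D≡) x∈D y∈D x≢y KBxy z∈D z≢x (≢-sym y≢z)
  ...       | f , (f∈D , f≢z , _) , KAzf , inj₁ KBzf = z , f , z∈D , f∈D , ≢-sym f≢z , KAzf , KBzf
  ...       | _ , _ , _ , inj₂ (inj₁ (KBzx , _)) =
    x , z , x∈D , z∈D , ≢-sym z≢x , KAxz , pair-comm {A = B} {K = K} z x KBzx
  ...       | _ , _ , _ , inj₂ (inj₂ (KBzy , _)) =
    y , z , y∈D , z∈D , y≢z , KAyz , pair-comm {A = B} {K = K} z y KBzy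

  -- Swinging the common edge to `a` in both graphs yields a common neighbour of `a` at once, unless
  -- `a` gets joined to different ends of that edge in the two graphs.
  commonEdge⇒exchange : K A → K B → A △ B ≡ D → CommonEdge A B → a ∈ D →
    ∃[ b ] b ∈ D × b ≢ a × PairSwap K A B a b
  commonEdge⇒exchange {A = A} {B = B} {a = a} KA KB D≡ (c , e , c∈D , e∈D , c≢e , KAce , KBce) a∈D
    with a ≟ c | a ≟ e
  ... | yes refl | _        = e , e∈D , ≢-sym c≢e , KAce , KBce
  ... | no  _    | yes refl = c , c∈D , c≢e , pair-comm {A = A} {K = K} c e KAce , pair-comm {A = B} {K = K} c e KBce
  ... | no  a≢c  | no  a≢e
    with swing KA KB D≡ c∈D e∈D c≢e KAce a∈D a≢c a≢e
       | swing KB KA (trans (△-comm B A) D≡) c∈D e∈D c≢e KBce a∈D a≢c a≢e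
  ...   | f , (f∈D , f≢a , _) , KBaf , inj₁ KAaf | _ = f , f∈D , f≢a , KAaf , KBaf
  ...   | _ | f , (f∈D , f≢a , _) , KAaf , inj₁ KBaf = f , f∈D , f≢a , KAaf , KBaf
  ...   | _ , _ , _ , inj₂ (inj₁ (KAac , _)) | _ , _ , _ , inj₂ (inj₁ (KBac , _)) =
    c , c∈D , ≢-sym a≢c , KAac , KBac
  ...   | _ , _ , _ , inj₂ (inj₂ (KAae , _)) | _ , _ , _ , inj₂ (inj₂ (KBae , _)) =
    e , e∈D , ≢-sym a≢e , KAae , KBae
  -- Here `a` is joined to `c` in `Edge A` but to `e` and `f` in `Edge B`. Swinging the edge between
  -- `e` and `f` in `Edge A` to `a` therefore succeeds in all three outcomes.
  ...   | f , (f∈D , f≢a , f≢c , f≢e) , KBaf , inj₂ (inj₁ (_ , KAef))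
        | _ , _ , _ , inj₂ (inj₂ (KBae , _))
    with swing KA KB D≡ e∈D f∈D (≢-sym f≢e) KAef a∈D a≢e (≢-sym f≢a)
  ...     | g , (g∈D , g≢a , _) , KBag , inj₁ KAag = g , g∈D , g≢a , KAag , KBag
  ...     | _ , _ , _ , inj₂ (inj₁ (KAae , _)) = e , e∈D , ≢-sym a≢e , KAae , KBae
  ...     | _ , _ , _ , inj₂ (inj₂ (KAaf , _)) = f , f∈D , f≢a , KAaf , KBaf
  commonEdge⇒exchange KA KB D≡ (c , e , c∈D , e∈D , c≢e , KAce , KBce) a∈D
        | no a≢c | no a≢e
        | f , (f∈D , f≢a , f≢c , f≢e) , KBaf , inj₂ (inj₂ (_ , KAcf))
        | _ , _ , _ , inj₂ (inj₁ (KBac , _))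
    with swing KA KB D≡ c∈D f∈D (≢-sym f≢c) KAcf a∈D a≢c (≢-sym f≢a)
  ...     | g , (g∈D , g≢a , _) , KBag , inj₁ KAag = g , g∈D , g≢a , KAag , KBag
  ...     | _ , _ , _ , inj₂ (inj₁ (KAac , _)) = c , c∈D , ≢-sym a≢c , KAac , KBac
  ...     | _ , _ , _ , inj₂ (inj₂ (KAaf , _)) = f , f∈D , f≢a , KAaf , KBaf

  -- Exchange between `A` and `C` provides an edge of `Edge A`, and exchange between `C` and `B` one
  -- of `Edge B`. The second difference is nonempty because it contains `y`, and it is strictly
  -- smaller because it misses `x`.
  between⇒exchangeable : ∀ {C} → K A → K B → A △ B ≡ D → K C → Nonempty (A △ C) → A △ C ⊂ D →
    Exchangeable K A B
  between⇒exchangeable {A = A} {B = B} {C = C} KA KB refl KC (x , x∈A△C) A△C⊂D@(A△C⊆D , y , y∈D , y∉A△C)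
    with below KA KC A△C⊂D x∈A△C | below KC KB C△B⊂D y∈C△B
    where
    C△B≡ : A △ B △ (A △ C) ≡ C △ B
    C△B≡ = solve 3 (λ A B C → A ⊕ B ⊕ (A ⊕ C) ⊜ C ⊕ B) refl A B C

    C△B⊂D : C △ B ⊂ A △ B
    C△B⊂D = (λ z∈ → △-⊆ (λ z → z) A△C⊆D (subst (_ ∈_) (sym C△B≡) z∈)) ,
            x , A△C⊆D x∈A△C , subst (x ∉_) C△B≡ (∉-△ (A△C⊆D x∈A△C) x∈A△C)

    y∈C△B : y ∈ C △ B
    y∈C△B = subst (y ∈_) C△B≡ (∈-△ˡ y∈D y∉A△C)
  ... | p , p∈ , p≢x , KAxp , _ | q , q∈ , q≢y , _ , KByq =
    commonEdge⇒exchange KA KB refl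
      (commonEdge KA KB refl (A△C⊆D x∈A△C) (A△C⊆D p∈) (≢-sym p≢x) KAxp y∈D (C△B⊆D q∈) (≢-sym q≢y) KByq)
    where
    C△B⊆D : C △ B ⊆ A △ B
    C△B⊆D z∈ = △-⊆ (λ z → z) A△C⊆D (subst (_ ∈_)
      (solve 3 (λ A B C → C ⊕ B ⊜ A ⊕ B ⊕ (A ⊕ C)) refl A B C) z∈)

-- Parity and the even lift.

parity : Subset n → Bool
parity []      = false
parity (s ∷ S) = s xor parity S

parity-△ : (S T : Subset n) → parity (S △ T) ≡ parity S xor parity T
parity-△ []          []          = refl
parity-△ (false ∷ S) (false ∷ T) = parity-△ S T
parity-△ (false ∷ S) (true  ∷ T) =
  trans (cong not (parity-△ S T)) (not-distribʳ-xor (parity S) (parity T))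
parity-△ (true  ∷ S) (false ∷ T) =
  trans (cong not (parity-△ S T)) (not-distribˡ-xor (parity S) (parity T))
parity-△ (true  ∷ S) (true  ∷ T) =
  trans (parity-△ S T) (sym (xor-annihilates-not (parity S) (parity T)))

parity-⊥ : ∀ n → parity (⊥ {n}) ≡ false
parity-⊥ zero  = refl
parity-⊥ (suc n) = parity-⊥ n

parity-⁅⁆ : (a : Fin n) → parity ⁅ a ⁆ ≡ true
parity-⁅⁆ {suc n} zero    = cong not (parity-⊥ n)
parity-⁅⁆         (suc a) = parity-⁅⁆ a

parity-remove : (S : Subset n) (a : Fin n) → parity (S △ ⁅ a ⁆) ≡ not (parity S)
parity-remove S a = trans (parity-△ S ⁅ a ⁆) (trans (cong (parity S xor_) (parity-⁅⁆ a)) (xor-true (parity S)))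
  where
  xor-true : ∀ x → x xor true ≡ not x
  xor-true false = refl
  xor-true true  = refl

odd⇒Nonempty : ∀ {n} {S : Subset n} → parity S ≡ true → Nonempty S
odd⇒Nonempty {n} odd = ≢⊥⇒Nonempty λ where refl → contradiction (trans (sym (parity-⊥ n)) odd) λ ()

-- Toggling one element makes an even set odd, hence nonempty. The elements of an even difference
-- can therefore be picked out two at a time.
remove-Nonempty : (S : Subset n) (a : Fin n) → parity S ≡ false → Nonempty (S △ ⁅ a ⁆)
remove-Nonempty S a even = odd⇒Nonempty (trans (parity-remove S a) (cong not even))

remove₂-even : (S : Subset n) (a b : Fin n) → parity S ≡ false → parity (S △ ⁅ a ⁆ △ ⁅ b ⁆) ≡ false
remove₂-even S a b even = trans (parity-remove (S △ ⁅ a ⁆) b)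
  (cong not (trans (parity-remove S a) (cong not even)))

xor≡false⇒≡ : ∀ {x y} → x xor y ≡ false → x ≡ y
xor≡false⇒≡ {false} {false} _ = refl
xor≡false⇒≡ {true}  {true}  _ = refl

⊆∧≢⇒⊂ : S ⊆ T → S ≢ T → S ⊂ T
⊆∧≢⇒⊂ {S = S} {T = T} S⊆T S≢T with ≢⊥⇒Nonempty (S≢T ∘ △≡⊥⇒≡)
... | x , x∈ with ∈-△⁻ x∈
...   | inj₁ (x∈S , x∉T) = contradiction (S⊆T x∈S) x∉T
...   | inj₂ (x∉S , x∈T) = S⊆T , x , x∈T , x∉S

-- In an even set the other bits determine the bit at `zero`, so equal tails would force equal sets.
-- Strictness thus passes to the tails, whose sizes drive the induction.
⊂-tail : {S T : Subset (suc n)} → parity S ≡ false → parity T ≡ false → S ⊂ T → tail S ⊂ tail T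
⊂-tail {S = s ∷ _} {T = t ∷ _} evenS evenT S⊂T = ⊆∧≢⇒⊂ (drop-∷-⊆ (proj₁ S⊂T)) λ where
  refl → ⊂-irref (cong (_∷ _) (trans (xor≡false⇒≡ {s} evenS) (sym (xor≡false⇒≡ {t} evenT)))) S⊂T

∣s∷S∣≤1+∣S∣ : ∀ s (S : Subset n) → ∣ s ∷ S ∣ ≤ suc ∣ S ∣
∣s∷S∣≤1+∣S∣ false S = n≤1+n ∣ S ∣
∣s∷S∣≤1+∣S∣ true  S = ≤-refl

tail-△ : (S T : Subset (suc n)) → tail (S △ T) ≡ tail S △ tail T
tail-△ (_ ∷ _) (_ ∷ _) = refl

⁅⁆-△≡∪ : a ≢ b → ⁅ a ⁆ △ ⁅ b ⁆ ≡ ⁅ a ⁆ ∪ ⁅ b ⁆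
⁅⁆-△≡∪ {a = zero}  {b = zero}  a≢b = contradiction refl a≢b
⁅⁆-△≡∪ {a = zero}  {b = suc b} a≢b = cong (true ∷_) (trans (△-identityˡ ⁅ b ⁆) (sym (∪-identityˡ ⁅ b ⁆)))
⁅⁆-△≡∪ {a = suc a} {b = zero}  a≢b = cong (true ∷_) (trans (△-identityʳ ⁅ a ⁆) (sym (∪-identityʳ ⁅ a ⁆)))
⁅⁆-△≡∪ {a = suc a} {b = suc b} a≢b = cong (false ∷_) (⁅⁆-△≡∪ (a≢b ∘ cong suc))

-- The new element zero makes every feasible set even.
record EvenLift (M : SetSystem n ℓ) (T : Subset (suc n)) : Set ℓ where
  constructor _,_
  field
    feasible : M (tail T)
    even     : parity T ≡ false

open EvenLift

evenLift : Subset n → Subset (suc n)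
evenLift S = parity S ∷ S

module _ {M : SetSystem n ℓ} where

  evenLift-feasible : M S → EvenLift M (evenLift S)
  evenLift-feasible {S = S} MS = MS , xor-same (parity S)

  even-△ : ∀ {A B} → EvenLift M A → EvenLift M B → parity (A △ B) ≡ false
  even-△ {A = A} {B = B} (_ , evenA) (_ , evenB) =
    trans (parity-△ A B) (cong₂ _xor_ evenA evenB)

  pair-feasible : ∀ {A} (a b : Fin (suc n)) → EvenLift M A →
    M (tail A △ tail (⁅ a ⁆ △ ⁅ b ⁆)) → EvenLift M (A △ (⁅ a ⁆ △ ⁅ b ⁆))
  pair-feasible {A = A} a b (_ , evenA) MA△ab =
    subst M (sym (tail-△ A (⁅ a ⁆ △ ⁅ b ⁆))) MA△ab , (begin
    parity (A △ (⁅ a ⁆ △ ⁅ b ⁆))          ≡⟨ parity-△ A (⁅ a ⁆ △ ⁅ b ⁆) ⟩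
    parity A xor parity (⁅ a ⁆ △ ⁅ b ⁆)   ≡⟨ cong (_xor _) evenA ⟩
    parity (⁅ a ⁆ △ ⁅ b ⁆)                ≡⟨ parity-remove ⁅ a ⁆ b ⟩
    not (parity ⁅ a ⁆)                    ≡⟨ cong not (parity-⁅⁆ a) ⟩
    false                                 ∎)
    where open ≡-Reasoning

  -- The tail of a pair formed by `zero` and another element is a singleton, so pair swaps in the
  -- lift account for swaps of one element of `M` as well as of two.
  pairSwap : ∀ {A B} (a b : Fin (suc n)) → EvenLift M A → EvenLift M B →
    Swap M (tail A) (tail B) (tail (⁅ a ⁆ △ ⁅ b ⁆)) → PairSwap (EvenLift M) A B a b
  pairSwap a b KA KB (M₁ , M₂) = pair-feasible a b KA M₁ , pair-feasible a b KB M₂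

-- Local exchange in the even lift.

module _ {M : SetSystem n ℓ} (M? : Decidable M)
  (¬peerless₃ : ¬ HasPeerlessAntipode M 3) (¬peerless₄ : ¬ HasPeerlessAntipode M 4) where
  open LocalExchange M? ¬peerless₃ ¬peerless₄

  private
    K = EvenLift M

    -- A swap at `b` or `c` alone is complemented to a pair containing `a`. The swap at `a` alone is
    -- kept, since in the lift `zero` becomes the partner of `a`.
    exchange₃′ : M A → M B → A △ B ≡ ⁅ a ⁆ △ ⁅ b ⁆ △ ⁅ c ⁆ → a ≢ b → a ≢ c → b ≢ c →
      Swap M A B ⁅ a ⁆ ⊎ PairSwap M A B a b ⊎ PairSwap M A B a c
    exchange₃′ {a = a} {b = b} {c = c} MA MB D≡ a≢b a≢c b≢c with exchange₃ MA MB D≡ a≢b a≢c b≢c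
    ... | here swap = inj₁ swap
    ... | there (here swap) = inj₂ (inj₂ (oppositeSwap {M = M} (trans D≡
      (solve 3 (λ a b c → a ⊕ b ⊕ c ⊜ b ⊕ (a ⊕ c)) refl ⁅ a ⁆ ⁅ b ⁆ ⁅ c ⁆)) swap))
    ... | there (there (here swap)) = inj₂ (inj₁ (oppositeSwap {M = M} (trans D≡
      (solve 3 (λ a b c → a ⊕ b ⊕ c ⊜ c ⊕ (a ⊕ b)) refl ⁅ a ⁆ ⁅ b ⁆ ⁅ c ⁆)) swap))

    pairSwap₀ : ∀ {A B} {b : Fin n} → K A → K B → Swap M (tail A) (tail B) ⁅ b ⁆ → PairSwap K A B zero (suc b)
    pairSwap₀ {b = b} KA KB swap =
      pairSwap zero (suc b) KA KB (sameSwap {M = M} (sym (△-identityˡ ⁅ b ⁆)) swap)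

    pairSwap₀′ : ∀ {A B} {b : Fin n} → K A → K B → Swap M (tail A) (tail B) ⁅ b ⁆ → PairSwap K A B (suc b) zero
    pairSwap₀′ {b = b} KA KB swap =
      pairSwap (suc b) zero KA KB (sameSwap {M = M} (sym (△-identityʳ ⁅ b ⁆)) swap)

  -- If `zero` is among the four elements, the tails differ in three elements and `exchange₃`
  -- applies; otherwise they differ in four and `exchange₄` does.
  evenLift-locallyExchangeable : LocallyExchangeable (EvenLift M)
  evenLift-locallyExchangeable {a = zero} {b = zero} _ _ _ a≢b _ _ _ _ _ = contradiction refl a≢b
  evenLift-locallyExchangeable {a = zero} {c = zero} _ _ _ _ a≢c _ _ _ _ = contradiction refl a≢c
  evenLift-locallyExchangeable {a = zero} {d = zero} _ _ _ _ _ a≢d _ _ _ = contradiction refl a≢d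
  evenLift-locallyExchangeable {b = zero} {c = zero} _ _ _ _ _ _ b≢c _ _ = contradiction refl b≢c
  evenLift-locallyExchangeable {b = zero} {d = zero} _ _ _ _ _ _ _ b≢d _ = contradiction refl b≢d
  evenLift-locallyExchangeable {c = zero} {d = zero} _ _ _ _ _ _ _ _ c≢d = contradiction refl c≢d
  evenLift-locallyExchangeable {α ∷ A} {β ∷ B} {zero} {suc b} {suc c} {suc d} KA KB D≡ _ _ _ b≢c b≢d c≢d =
    Any.map⁺ (Any.map (pairSwap₀ KA KB) (exchange₃ (feasible KA) (feasible KB)
      (trans (cong tail D≡) (cong (λ T → T △ ⁅ c ⁆ △ ⁅ d ⁆) (△-identityˡ ⁅ b ⁆)))
      (b≢c ∘ cong suc) (b≢d ∘ cong suc) (c≢d ∘ cong suc)))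
  evenLift-locallyExchangeable {α ∷ A} {β ∷ B} {suc a} {zero} {suc c} {suc d} KA KB D≡ _ a≢c a≢d _ _ c≢d
    with exchange₃′ (feasible KA) (feasible KB)
      (trans (cong tail D≡) (cong (λ T → T △ ⁅ c ⁆ △ ⁅ d ⁆) (△-identityʳ ⁅ a ⁆)))
      (a≢c ∘ cong suc) (a≢d ∘ cong suc) (c≢d ∘ cong suc)
  ... | inj₁ swap        = here (pairSwap₀′ KA KB swap)
  ... | inj₂ (inj₁ swap) = there (here (pairSwap (suc a) (suc c) KA KB swap))
  ... | inj₂ (inj₂ swap) = there (there (here (pairSwap (suc a) (suc d) KA KB swap)))
  evenLift-locallyExchangeable {α ∷ A} {β ∷ B} {suc a} {suc b} {zero} {suc d} KA KB D≡ a≢b _ a≢d _ b≢d _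
    with exchange₃′ (feasible KA) (feasible KB)
      (trans (cong tail D≡) (cong (_△ ⁅ d ⁆) (△-identityʳ (⁅ a ⁆ △ ⁅ b ⁆))))
      (a≢b ∘ cong suc) (a≢d ∘ cong suc) (b≢d ∘ cong suc)
  ... | inj₁ swap        = there (here (pairSwap₀′ KA KB swap))
  ... | inj₂ (inj₁ swap) = here (pairSwap (suc a) (suc b) KA KB swap)
  ... | inj₂ (inj₂ swap) = there (there (here (pairSwap (suc a) (suc d) KA KB swap)))
  evenLift-locallyExchangeable {α ∷ A} {β ∷ B} {suc a} {suc b} {suc c} {zero} KA KB D≡ a≢b a≢c _ b≢c _ _
    with exchange₃′ (feasible KA) (feasible KB)
      (trans (cong tail D≡) (△-identityʳ (⁅ a ⁆ △ ⁅ b ⁆ △ ⁅ c ⁆)))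
      (a≢b ∘ cong suc) (a≢c ∘ cong suc) (b≢c ∘ cong suc)
  ... | inj₁ swap        = there (there (here (pairSwap₀′ KA KB swap)))
  ... | inj₂ (inj₁ swap) = here (pairSwap (suc a) (suc b) KA KB swap)
  ... | inj₂ (inj₂ swap) = there (here (pairSwap (suc a) (suc c) KA KB swap))
  evenLift-locallyExchangeable {α ∷ A} {β ∷ B} {suc a} {suc b} {suc c} {suc d} KA KB D≡ a≢b a≢c a≢d b≢c b≢d c≢d =
    Any.map⁺ (Any.map (λ {x} → pairSwap (suc a) (suc x) KA KB) (exchange₄ (feasible KA) (feasible KB) (cong tail D≡)
      (a≢b ∘ cong suc) (a≢c ∘ cong suc) (a≢d ∘ cong suc)
      (b≢c ∘ cong suc) (b≢d ∘ cong suc) (c≢d ∘ cong suc)))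

  -- Induction for larger differences.

  module _ (¬isolated : ∀ k → 5 ≤ k → ¬ HasIsolatedAntipode M k) where

    private
      -- The size is counted without `zero`, so that the hypothesis also covers differences
      -- containing `zero` when `A △ B` does not. Such differences occur in
      -- `oddBetween⇒exchangeable`.
      ShorterExchange : (A B : Subset (suc n)) → Set ℓ
      ShorterExchange A B = ∀ {A₁ B₁} → K A₁ → K B₁ →
        ∣ tail (A₁ △ B₁) ∣ < ∣ tail (A △ B) ∣ → Exchangeable K A₁ B₁

    module LongExchange {α β A B} (KA : K (α ∷ A)) (KB : K (β ∷ B))
      (5≤ : 5 ≤ ∣ A △ B ∣) (shorter : ShorterExchange (α ∷ A) (β ∷ B)) where

      below : ExchangeableBelow K ((α ∷ A) △ (β ∷ B))
      below KA₁ KB₁ ⊂D = shorter KA₁ KB₁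
        (p⊂q⇒∣p∣<∣q∣ (⊂-tail (even-△ KA₁ KB₁) (even-△ KA KB) ⊂D))

      -- Only the bit at `zero` could take the lift of `C` out of the cube, and the last hypothesis
      -- rules this out. Strictness is inherited from the tails.
      liftedBetween⇒exchangeable : M C → Nonempty (A △ C) → A △ C ⊂ A △ B →
        (zero ∈ (α ∷ A) △ evenLift C → α xor β ≡ true) → Exchangeable K (α ∷ A) (β ∷ B)
      liftedBetween⇒exchangeable {C = C} MC (x , x∈) A△C⊂A△B head =
        Exchange.between⇒exchangeable evenLift-locallyExchangeable below
          KA KB refl (evenLift-feasible MC) (suc x , there x∈)
          (⊆∧≢⇒⊂ ⊆D λ eq → ⊂-irref (cong tail eq) A△C⊂A△B)
        where
        ⊆D : (α ∷ A) △ evenLift C ⊆ (α ∷ A) △ (β ∷ B)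
        ⊆D {zero}  z∈         = subst (λ δ → zero ∈ δ ∷ (A △ B)) (sym (head z∈)) here
        ⊆D {suc _} (there y∈) = there (proj₁ A△C⊂A△B y∈)

      -- As `A` and `C` have the same parity, their lifts agree at `zero`, and the condition on
      -- `zero` holds vacuously.
      evenBetween⇒exchangeable : M C → Nonempty (A △ C) → A △ C ⊂ A △ B →
        parity (A △ C) ≡ false → Exchangeable K (α ∷ A) (β ∷ B)
      evenBetween⇒exchangeable {C = C} MC nonempty A△C⊂A△B evenA△C =
        liftedBetween⇒exchangeable MC nonempty A△C⊂A△B
          λ z∈ → contradiction (trans (sym (head z∈)) α≡C) λ ()
        where
        head : zero ∈ (α ∷ A) △ evenLift C → α xor parity C ≡ true
        head z∈ with true ← α xor parity C | here ← z∈ = refl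

        α≡C : α xor parity C ≡ false
        α≡C = trans (cong (_xor parity C) (xor≡false⇒≡ {α} (even KA)))
                    (trans (sym (parity-△ A C)) evenA△C)

      -- An odd C is corrected by exchanging zero between A and C; if that only
      -- returns A itself, then C is A △ {b}, and zero is exchanged between C and B.
      oddBetween⇒exchangeable : M C → A △ C ⊂ A △ B → parity (A △ C) ≡ true →
        parity (A △ B) ≡ false → Exchangeable K (α ∷ A) (β ∷ B)
      oddBetween⇒exchangeable {C = C} MC A△C⊂A△B@(A△C⊆A△B , _) oddA△C evenA△B
        with shorter KA (evenLift-feasible MC) (p⊂q⇒∣p∣<∣q∣ A△C⊂A△B) zero∈A△C
        where
        zero∈A△C : zero ∈ (α ∷ A) △ evenLift C
        zero∈A△C = subst (λ δ → zero ∈ δ ∷ (A △ C)) (sym (trans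
          (cong (_xor parity C) (xor≡false⇒≡ {α} (even KA)))
          (trans (sym (parity-△ A C)) oddA△C))) here
      ... | zero  , _ , 0≢0 , _ = contradiction refl 0≢0
      ... | suc b , there b∈A△C , _ , _ , KC0b with nonempty? (A △ C △ ⁅ b ⁆)
      ...   | yes nonempty = evenBetween⇒exchangeable {C = C △ ⁅ b ⁆}
        (subst (M ∘ (C △_)) (△-identityˡ ⁅ b ⁆) (feasible KC0b))
        (subst Nonempty (△-assoc A C ⁅ b ⁆) nonempty)
        (subst (_⊂ A △ B) (△-assoc A C ⁅ b ⁆)
          ( (λ x∈ → A△C⊆A△B (proj₁ (∈-remove⁻ b∈A△C x∈)))
          , b , A△C⊆A△B b∈A△C , ∉-remove b∈A△C))
        (trans (cong parity (sym (△-assoc A C ⁅ b ⁆)))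
          (trans (parity-remove (A △ C) b) (cong not oddA△C)))
      ...   | no empty with shorter (evenLift-feasible MC) KB (p⊂q⇒∣p∣<∣q∣ C△B⊂A△B) zero∈C△B
        where
        C△B≡ : C △ B ≡ A △ B △ (A △ C)
        C△B≡ = solve 3 (λ A B C → C ⊕ B ⊜ A ⊕ B ⊕ (A ⊕ C)) refl A B C

        C△B⊂A△B : C △ B ⊂ A △ B
        C△B⊂A△B = subst (_⊂ A △ B) (sym C△B≡)
          ( △-⊆ (λ x∈ → x∈) A△C⊆A△B
          , b , A△C⊆A△B b∈A△C , ∉-△ (A△C⊆A△B b∈A△C) b∈A△C)

        zero∈C△B : zero ∈ evenLift C △ (β ∷ B)
        zero∈C△B = subst (λ δ → zero ∈ δ ∷ (C △ B)) (sym (begin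
          parity C xor β                          ≡⟨ cong (parity C xor_) (xor≡false⇒≡ {β} (even KB)) ⟩
          parity C xor parity B                   ≡⟨ parity-△ C B ⟨
          parity (C △ B)                          ≡⟨ cong parity C△B≡ ⟩
          parity (A △ B △ (A △ C))                ≡⟨ parity-△ (A △ B) (A △ C) ⟩
          parity (A △ B) xor parity (A △ C)       ≡⟨ cong₂ _xor_ evenA△B oddA△C ⟩
          true                                    ∎)) here
          where open ≡-Reasoning
      ...     | zero  , _ , 0≢0 , _ = contradiction refl 0≢0
      ...     | suc c , there c∈C△B , _ , KC0c , _ = evenBetween⇒exchangeable {C = C △ ⁅ c ⁆}
        (subst (M ∘ (C △_)) (△-identityˡ ⁅ c ⁆) (feasible KC0c))
        (subst Nonempty bc≡ (b , ∈-△ˡ (x∈⁅x⁆ b) (x≢y⇒x∉⁅y⁆ (≢-sym c≢b))))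
        (⊆∧≢⇒⊂ (subst (_⊆ A △ B) (△-assoc A C ⁅ c ⁆) (△-⊆ A△C⊆A△B c⊆A△B)) ≢D)
        (trans (cong parity (sym (△-assoc A C ⁅ c ⁆)))
          (trans (parity-remove (A △ C) c) (cong not oddA△C)))
        where
        A△C≡b : A △ C ≡ ⁅ b ⁆
        A△C≡b = △≡⊥⇒≡ (Empty-unique empty)

        bc≡ : ⁅ b ⁆ △ ⁅ c ⁆ ≡ A △ (C △ ⁅ c ⁆)
        bc≡ = trans (cong (_△ ⁅ c ⁆) (sym A△C≡b)) (△-assoc A C ⁅ c ⁆)

        c∈ : c ∈ A △ B △ (A △ C)
        c∈ = subst (c ∈_) (solve 3 (λ A B C → C ⊕ B ⊜ A ⊕ B ⊕ (A ⊕ C)) refl A B C) c∈C△B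

        c≢b : c ≢ b
        c≢b refl = ∉-△ (A△C⊆A△B b∈A△C) b∈A△C c∈

        c⊆A△B : ⁅ c ⁆ ⊆ A △ B
        c⊆A△B x∈ = subst (_∈ A △ B) (sym (x∈⁅y⁆⇒x≡y c x∈)) (△-⊆ (λ y∈ → y∈) A△C⊆A△B c∈)

        -- The set on the left consists of `b` and `c`, too few elements to be `A △ B`.
        ≢D : A △ (C △ ⁅ c ⁆) ≢ A △ B
        ≢D eq with s≤s (s≤s ()) ← subst (5 ≤_) (trans (cong ∣_∣ (trans (sym eq) (sym bc≡)))
          (trans (∣add∣ (x≢y⇒x∉⁅y⁆ c≢b)) (cong suc (∣⁅x⁆∣≡1 b)))) 5≤

      -- If `α` and `β` differ, any `C` strictly between `A` and `B` lifts into the cube. Otherwise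
      -- `A △ B` is even, and the parity of `A △ C` decides whether `C` lifts directly or has to be
      -- corrected first.
      longExchange : Exchangeable K (α ∷ A) (β ∷ B)
      longExchange with ¬isolated⇒between M? (feasible KA) (feasible KB) refl (¬isolated _ 5≤)
      ... | C , MC , A△C⊆A△B , C≢A , C≢B = byParity (α xor β ≟ᵇ true) (parity (A △ C) ≟ᵇ false)
        where
        A△C⊂A△B : A △ C ⊂ A △ B
        A△C⊂A△B = ⊆∧≢⇒⊂ A△C⊆A△B λ eq → C≢B (begin
          C            ≡⟨ solve 2 (λ A C → C ⊜ A ⊕ (A ⊕ C)) refl A C ⟩
          A △ (A △ C)  ≡⟨ cong (A △_) eq ⟩
          A △ (A △ B)  ≡⟨ solve 2 (λ A B → A ⊕ (A ⊕ B) ⊜ B) refl A B ⟩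
          B            ∎)
          where open ≡-Reasoning

        nonempty : Nonempty (A △ C)
        nonempty = ≢⊥⇒Nonempty (C≢A ∘ sym ∘ △≡⊥⇒≡)

        byParity : Dec (α xor β ≡ true) → Dec (parity (A △ C) ≡ false) → Exchangeable K (α ∷ A) (β ∷ B)
        byParity (yes odd) _ = liftedBetween⇒exchangeable MC nonempty A△C⊂A△B λ _ → odd
        byParity _ (yes evenA△C) = evenBetween⇒exchangeable MC nonempty A△C⊂A△B evenA△C
        byParity (no ¬odd) (no ¬even) = oddBetween⇒exchangeable MC A△C⊂A△B
          (¬-not ¬even)
          (trans (sym (xor≡false⇒≡ {α xor β} (even-△ KA KB))) (¬-not ¬odd))

    -- The even difference is exhausted in pairs. If it has two elements, the swap interchanges `A`
    -- and `B`; four elements are the local case; of six or more, at least five differ from `zero`,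
    -- as `LongExchange` requires.
    evenExchange : ∀ m {A B} → K A → K B → ∣ tail (A △ B) ∣ < m → Exchangeable K A B
    evenExchange (suc m) {A} {B} KA KB ∣D∣<m {a} a∈D
      with remove-Nonempty (A △ B) a (even-△ KA KB)
    ... | b , b∈D₁ with ∈-remove⁻ a∈D b∈D₁ | nonempty? (A △ B △ ⁅ a ⁆ △ ⁅ b ⁆)
    ...   | b∈D , b≢a | no empty = b , b∈D , b≢a ,
      subst K (△≡⊥⇒≡ (trans (solve 4 (λ A B a b → B ⊕ (A ⊕ (a ⊕ b)) ⊜ A ⊕ B ⊕ a ⊕ b)
        refl A B ⁅ a ⁆ ⁅ b ⁆) (Empty-unique empty))) KB ,
      subst K (△≡⊥⇒≡ (trans (solve 4 (λ A B a b → A ⊕ (B ⊕ (a ⊕ b)) ⊜ A ⊕ B ⊕ a ⊕ b)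
        refl A B ⁅ a ⁆ ⁅ b ⁆) (Empty-unique empty))) KA
    ...   | b∈D , b≢a | yes (c , c∈D₂) with remove-Nonempty (A △ B △ ⁅ a ⁆ △ ⁅ b ⁆) c
                 (remove₂-even (A △ B) a b (even-△ KA KB))
    ...     | d , d∈D₃ with nonempty? (A △ B △ ⁅ a ⁆ △ ⁅ b ⁆ △ ⁅ c ⁆ △ ⁅ d ⁆)
    ...       | no empty = 4-element
      where
      c∈D₁ = ∈-remove⁻ b∈D₁ c∈D₂
      c∈D  = ∈-remove⁻ a∈D (proj₁ c∈D₁)
      d∈D₂ = ∈-remove⁻ c∈D₂ d∈D₃
      d∈D₁ = ∈-remove⁻ b∈D₁ (proj₁ d∈D₂)
      d∈D  = ∈-remove⁻ a∈D (proj₁ d∈D₁)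

      D≡ : A △ B ≡ ⁅ a ⁆ △ ⁅ b ⁆ △ ⁅ c ⁆ △ ⁅ d ⁆
      D≡ = △≡⊥⇒≡ (trans (solve 5 (λ D a b c d → D ⊕ (a ⊕ b ⊕ c ⊕ d) ⊜ D ⊕ a ⊕ b ⊕ c ⊕ d)
        refl (A △ B) ⁅ a ⁆ ⁅ b ⁆ ⁅ c ⁆ ⁅ d ⁆) (Empty-unique empty))

      4-element : ∃[ x ] x ∈ A △ B × x ≢ a × PairSwap K A B a x
      4-element with evenLift-locallyExchangeable KA KB D≡
        (≢-sym b≢a) (≢-sym (proj₂ c∈D)) (≢-sym (proj₂ d∈D))
        (≢-sym (proj₂ c∈D₁)) (≢-sym (proj₂ d∈D₁)) (≢-sym (proj₂ d∈D₂))
      ... | here swap                 = b , b∈D , b≢a , swap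
      ... | there (here swap)         = c , proj₁ c∈D , proj₂ c∈D , swap
      ... | there (there (here swap)) = d , proj₁ d∈D , proj₂ d∈D , swap
    ...       | yes (e , e∈D₄) with remove-Nonempty (A △ B △ ⁅ a ⁆ △ ⁅ b ⁆ △ ⁅ c ⁆ △ ⁅ d ⁆) e
                 (remove₂-even (A △ B △ ⁅ a ⁆ △ ⁅ b ⁆) c d (remove₂-even (A △ B) a b (even-△ KA KB)))
    evenExchange (suc m) {α ∷ A} {β ∷ B} KA KB ∣D∣<m {a} a∈D
        | b , b∈D₁ | _ | yes (c , c∈D₂) | d , d∈D₃ | yes (e , e∈D₄) | f , f∈D₅ =
      LongExchange.longExchange KA KB 5≤∣A△B∣ shorter a∈D
      where
      6≤∣D∣ : 6 ≤ ∣ (α ∷ A) △ (β ∷ B) ∣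
      6≤∣D∣ = subst (6 ≤_) (sym (trans (∣remove∣ a∈D) (cong suc (trans (∣remove∣ b∈D₁)
        (cong suc (trans (∣remove∣ c∈D₂) (cong suc (trans (∣remove∣ d∈D₃)
        (cong suc (trans (∣remove∣ e∈D₄) (cong suc (∣remove∣ f∈D₅)))))))))))) (m≤m+n 6 _)

      5≤∣A△B∣ : 5 ≤ ∣ A △ B ∣
      5≤∣A△B∣ = s≤s⁻¹ (≤-trans 6≤∣D∣ (∣s∷S∣≤1+∣S∣ (α xor β) (A △ B)))

      shorter : ShorterExchange (α ∷ A) (β ∷ B)
      shorter KA₁ KB₁ lt = evenExchange m KA₁ KB₁ (<-≤-trans lt (s≤s⁻¹ ∣D∣<m))

    -- In the lift the partner of `a` is always a different element. If it is `zero`, only `a` is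
    -- toggled in `M`, and `a` serves as its own partner.
    strongExchange : M A → M B → a ∈ A △ B → ∃[ b ] b ∈ A △ B × Swap M A B (⁅ a ⁆ ∪ ⁅ b ⁆)
    strongExchange {a = a} MA MB a∈
      with evenExchange _ (evenLift-feasible MA) (evenLift-feasible MB) ≤-refl (there a∈)
    ... | zero  , _ , _ , KA , KB = a , a∈ ,
      sameSwap {M = M} (trans (△-identityʳ ⁅ a ⁆) (sym (∪-idem ⁅ a ⁆))) (feasible KA , feasible KB)
    ... | suc b , there b∈ , b≢a , KA , KB = b , b∈ ,
      sameSwap {M = M} (⁅⁆-△≡∪ (b≢a ∘ cong suc ∘ sym)) (feasible KA , feasible KB)

    isStrongΔMatroid : IsStrongΔMatroid M
    isStrongΔMatroid = isΔMatroid , hyperplaneExchange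
      where
      isΔMatroid : IsΔMatroid M
      isΔMatroid A B MA MB a a∈ with strongExchange MA MB a∈
      ... | b , b∈ , MA′ , _ = b , b∈ , MA′

      hyperplaneExchange : HyperplaneExchange M
      hyperplaneExchange A B MA MB A≢B with ≢⊥⇒Nonempty (A≢B ∘ △≡⊥⇒≡)
      ... | a , a∈ with strongExchange MA MB a∈
      ...   | b , b∈ , swap = a , b , a∈ , b∈ , swap

-- Necessity of the conditions, and the equivalence.

hyperplaneExchange⇒properSwap : {M : SetSystem n ℓ} → HyperplaneExchange M →
  M A → M B → 3 ≤ ∣ A △ B ∣ → ProperSwap M A B
hyperplaneExchange⇒properSwap {n = n} {A = A} {B = B} exchange MA MB 3≤ with exchange A B MA MB A≢B
  where
  A≢B : A ≢ B
  A≢B refl with () ← subst (3 ≤_) (trans (cong ∣_∣ (△-self A)) (∣⊥∣≡0 n)) 3≤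
... | a , b , a∈ , b∈ , swap = ⁅ a ⁆ ∪ ⁅ b ⁆ , ⊆D , ≢⊥ , ≢D , swap
  where
  singleton-⊆ : x ∈ A △ B → ⁅ x ⁆ ⊆ A △ B
  singleton-⊆ {x = x} x∈ y∈ = subst (_∈ A △ B) (sym (x∈⁅y⁆⇒x≡y x y∈)) x∈

  ⊆D : ⁅ a ⁆ ∪ ⁅ b ⁆ ⊆ A △ B
  ⊆D x∈ with x∈p∪q⁻ ⁅ a ⁆ ⁅ b ⁆ x∈
  ... | inj₁ x∈a = singleton-⊆ a∈ x∈a
  ... | inj₂ x∈b = singleton-⊆ b∈ x∈b

  ≢⊥ : ⁅ a ⁆ ∪ ⁅ b ⁆ ≢ ⊥
  ≢⊥ eq = ∉⊥ (subst (a ∈_) eq (x∈p∪q⁺ (inj₁ (x∈⁅x⁆ a))))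

  -- The exchanged set has one or two elements, according to whether `a` equals `b`, while `A △ B`
  -- has at least three.
  ≢D : ⁅ a ⁆ ∪ ⁅ b ⁆ ≢ A △ B
  ≢D eq with a ≟ b
  ... | yes refl with s≤s () ← subst (3 ≤_)
    (trans (cong ∣_∣ (trans (sym eq) (∪-idem ⁅ a ⁆))) (∣⁅x⁆∣≡1 a)) 3≤
  ... | no a≢b with s≤s (s≤s ()) ← subst (3 ≤_)
    (trans (cong ∣_∣ (trans (sym eq) (sym (⁅⁆-△≡∪ a≢b))))
      (trans (∣add∣ (x≢y⇒x∉⁅y⁆ (≢-sym a≢b))) (cong suc (∣⁅x⁆∣≡1 a)))) 3≤

proposition3p20 : ∀ {ℓ : Level} (n : ℕ) (M : SetSystem n ℓ) → Decidable M →
    IsStrongΔMatroid M ⇔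
    ((¬ HasPeerlessAntipode M 3 × ¬ HasPeerlessAntipode M 4)
    × (∀ k → 5 ≤ k → ¬ HasIsolatedAntipode M k))
proposition3p20 n M M? = mk⇔
  (λ (_ , exchange) →
    ( ¬peerless exchange (s≤s (s≤s (s≤s z≤n)))
    , ¬peerless exchange (s≤s (s≤s (s≤s z≤n))))
    , λ k 5≤k (A , B , MA , MB , ∣A△B∣≡k , isolated) →
        ¬peerless exchange (≤-trans (s≤s (s≤s (s≤s z≤n))) 5≤k)
          (A , B , MA , MB , ∣A△B∣≡k , isolated⇒peerless isolated))
  (λ ((¬peerless₃ , ¬peerless₄) , ¬isolated) → isStrongΔMatroid M? ¬peerless₃ ¬peerless₄ ¬isolated)
  where
  ¬peerless : ∀ {k} → HyperplaneExchange M → 3 ≤ k → ¬ HasPeerlessAntipode M k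
  ¬peerless exchange 3≤k (A , B , MA , MB , ∣A△B∣≡k , peerless) = properSwap⇒¬peerless
    (hyperplaneExchange⇒properSwap exchange MA MB (subst (3 ≤_) (sym ∣A△B∣≡k) 3≤k)) peerless
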